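{- Let $\Lambda^{2,2}_\omega(n)$ denote the set of $\pi\in\Lambda^{2,2}(n)$ with $\omega(\pi)=\omega$. Then \begin{align*} \sum_{\omega=-\infty}^{\infty} \sum_{n \ge 0} |\Lambda_{\omega}^{2,2}(n )| \, x^{\omega} q^n &=\sum_{n\ge 0} \frac{x^{ -n} q^{n(2n+1)}}{(q^2;q^2)_{2n}} \sum_{j=0}^{2n} x^j q^j \begin{bmatrix} 2n \\ j \end{bmatrix}_{q^2} \sum_{k=-n}^{n} x^{k} q^{2k^2-k} \begin{bmatrix} 2n \\ n+k \end{bmatrix}_{q^2} \\ &\quad + \sum_{n\ge 0} \frac{x^{n+1} q^{(n+1)(2n+1)}}{(q^2;q^2)_{2n+1}} \sum_{j=0}^{2n+1} x^{ -j} q^j \begin{bmatrix} 2n+1\\ j \end{bmatrix}_{q^2} \sum_{k=-n}^{n+1} x^k q^{2k^2-k} \begin{bmatrix} 2n +1 \\ n+k\end{bmatrix}_{q^2}. \end{align*}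
   Context: $\Lambda^{2,2}(n)$ is the set of pairs $(\pi^{(1)},\pi^{(2)})$ of partitions into distinct parts with $|\pi^{(1)}|+|\pi^{(2)}|=n$ and $\pi^{(1)}_1\le \ell(\pi^{(2)})$ (largest part of the empty partition is $0$; $\ell$ = number of parts). For a node $(i,j)$ (row $i$, column $j$) of the Young diagram of either component, its residue is $(j-i)\bmod 2$; $\omega(\pi)$ is the number of nodes of residue $0$ minus the number of nodes of residue $1$, over both components. $(z;q)_n=\prod_{j=0}^{n-1}(1-zq^j)$, and $\begin{bmatrix} N\\ M\end{bmatrix}_{q}=\frac{(q;q)_N}{(q;q)_M(q;q)_{N-M}}$ for $0\le M\le N$ and $0$ otherwise. -}

module Defs where

open import Data.Nat as ℕ using (ℕ; zero; suc; _<_; _≤_; _>_; _≤ᵇ_)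
open import Data.Integer as ℤ using (ℤ; +_; _-_; -_; 0ℤ; 1ℤ; _≟_)
open import Data.Nat.ListAction using (sum)
open import Data.List using (List; []; _∷_; length; map; concatMap; _++_; upTo; zipWith; foldr)
open import Data.List.Relation.Unary.All using (All)
open import Data.List.Relation.Unary.Linked using (Linked)
open import Data.Product using (_×_; _,_; Σ; proj₁; proj₂)
open import Data.Bool using (Bool; true; false; if_then_else_)
open import Relation.Nullary.Decidable using (⌊_⌋)
open import Relation.Binary.PropositionalEquality using (_≡_)

record DistinctPartition : Set where
  constructor mkDP
  field
    parts    : List ℕ
    strict   : Linked _>_ parts
    positive : All (0 <_) parts

open DistinctPartition public

size : DistinctPartition → ℕ
size π = sum (parts π)

len : DistinctPartition → ℕ
len π = length (parts π)

largest : DistinctPartition → ℕ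
largest π with parts π
... | []    = 0
... | x ∷ _ = x

record Λ22 (n : ℕ) : Set where
  constructor mkΛ
  field
    π₁ : DistinctPartition
    π₂ : DistinctPartition
    total : size π₁ ℕ.+ size π₂ ≡ n
    cond  : largest π₁ ≤ len π₂

open Λ22 public

-- sgn m = (-1)^m : +1 for residue 0, -1 for residue 1
sgn : ℕ → ℤ
sgn zero    = 1ℤ
sgn (suc m) = - sgn m

-- contribution of row i (1-indexed) with λ nodes (columns j = 1..λ):
-- Σ_{j=1}^{λ} (-1)^{j-i}  (note (-1)^{j-i} = (-1)^{j+i})
rowWeight : ℕ → ℕ → ℤ
rowWeight i zero    = 0ℤ
rowWeight i (suc l) = rowWeight i l ℤ.+ sgn (suc l ℕ.+ i)

rowsWeight : ℕ → List ℕ → ℤ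
rowsWeight i []       = 0ℤ
rowsWeight i (l ∷ ls) = rowWeight i l ℤ.+ rowsWeight (suc i) ls

-- (#residue-0 nodes) - (#residue-1 nodes) of one Young diagram
ωDP : DistinctPartition → ℤ
ωDP π = rowsWeight 1 (parts π)

ω : ∀ {n} → Λ22 n → ℤ
ω p = ωDP (π₁ p) ℤ.+ ωDP (π₂ p)

Λ22ω : ℕ → ℤ → Set
Λ22ω n w = Σ (Λ22 n) (λ p → ω p ≡ w)

-- Laurent polynomials in x over ℤ (as finite lists of monomials
-- (exponent , coefficient)), and formal power series in q over them.

LPoly : Set
LPoly = List (ℤ × ℤ)

coeffX : LPoly → ℤ → ℤ
coeffX []              w = 0ℤ
coeffX ((e , c) ∷ ps)  w = (if ⌊ e ≟ w ⌋ then c else 0ℤ) ℤ.+ coeffX ps w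

lzero lone : LPoly
lzero = []
lone  = (0ℤ , 1ℤ) ∷ []

_⊕_ : LPoly → LPoly → LPoly
p ⊕ r = p ++ r

lneg : LPoly → LPoly
lneg = map (λ { (e , c) → (e , - c) })

_⊗_ : LPoly → LPoly → LPoly
p ⊗ r = concatMap (λ { (e , c) → map (λ { (e' , c') → (e ℤ.+ e' , c ℤ.* c') }) r }) p

lsum : List LPoly → LPoly
lsum = foldr _⊕_ lzero

Series : Set
Series = ℕ → LPoly

szero sone : Series
szero N = lzero
sone zero    = lone
sone (suc N) = lzero

_+ₛ_ : Series → Series → Series
(f +ₛ g) N = f N ⊕ g N

-ₛ_ : Series → Series
(-ₛ f) N = lneg (f N)

_*ₛ_ : Series → Series → Series
(f *ₛ g) N = lsum (map (λ i → f i ⊗ g (N ℕ.∸ i)) (upTo (suc N)))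

Σₛ : ℕ → (ℕ → Series) → Series
Σₛ zero    F = szero
Σₛ (suc m) F = Σₛ m F +ₛ F m

Πₛ : ℕ → (ℕ → Series) → Series
Πₛ zero    F = sone
Πₛ (suc m) F = Πₛ m F *ₛ F m

-- the monomial x^a q^e (e is a nonnegative integer in all uses)
mono : ℤ → ℤ → Series
mono a e N = if ⌊ (+ N) ≟ e ⌋ then (a , 1ℤ) ∷ [] else lzero

-- multiplicative inverse of a series f with constant term 1:
-- g_0 = 1 , g_N = - Σ_{i=1}^{N} f_i g_{N-i}.
-- invRev f N = [g_N , g_{N-1} , … , g_0]
invRev : Series → ℕ → List LPoly
invRev f zero    = lone ∷ []
invRev f (suc N) =
  let prev = invRev f N
  in lneg (lsum (zipWith (λ i g → f (suc i) ⊗ g) (upTo (suc N)) prev)) ∷ prev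

inv : Series → Series
inv f N with invRev f N
... | []    = lzero
... | g ∷ _ = g

poch2 : ℕ → Series
poch2 m = Πₛ m (λ j → sone +ₛ (-ₛ mono 0ℤ (+ (2 ℕ.* (suc j)))))

qbin2 : ℕ → ℕ → Series
qbin2 N M = if M ≤ᵇ N
            then (poch2 N *ₛ inv (poch2 M)) *ₛ inv (poch2 (N ℕ.∸ M))
            else szero

kmono : ℤ → Series
kmono k = mono k (2ℤ* (k ℤ.* k) - k)
  where
  2ℤ* : ℤ → ℤ
  2ℤ* z = (+ 2) ℤ.* z

term₁ : ℕ → Series
term₁ n =
  ((mono (- (+ n)) (+ (n ℕ.* (2 ℕ.* n ℕ.+ 1))) *ₛ inv (poch2 (2 ℕ.* n)))
    *ₛ Σₛ (suc (2 ℕ.* n)) (λ j → mono (+ j) (+ j) *ₛ qbin2 (2 ℕ.* n) j))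
    -- k = k' - n , k' = n + k ∈ [0 , 2n]
    *ₛ Σₛ (suc (2 ℕ.* n)) (λ k' → kmono ((+ k') - (+ n)) *ₛ qbin2 (2 ℕ.* n) k')

term₂ : ℕ → Series
term₂ n =
  ((mono (+ suc n) (+ (suc n ℕ.* (2 ℕ.* n ℕ.+ 1))) *ₛ inv (poch2 (2 ℕ.* n ℕ.+ 1)))
    *ₛ Σₛ (suc (2 ℕ.* n ℕ.+ 1)) (λ j → mono (- (+ j)) (+ j) *ₛ qbin2 (2 ℕ.* n ℕ.+ 1) j))
    -- k = k' - n , k' = n + k ∈ [0 , 2n+1]
    *ₛ Σₛ (suc (2 ℕ.* n ℕ.+ 1)) (λ k' → kmono ((+ k') - (+ n)) *ₛ qbin2 (2 ℕ.* n ℕ.+ 1) k')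

-- Σ_{n ≥ 0} (term₁ n + term₂ n).  The n-th summand is divisible by q^n
-- (its q-valuation is ≥ n(2n+1) resp. (n+1)(2n+1), both ≥ n), so the
-- coefficient of q^N of the infinite sum is that of the partial sum n ≤ N.
RHS : Series
RHS N = Σₛ (suc N) (λ n → term₁ n +ₛ term₂ n) N

{-# OPTIONS --safe #-}
-- Fix the number m of parts of π⁽²⁾. A row of length l and index i contributes (−1)^(i+1) to ω
-- if l is odd and 0 otherwise, so removing the first row or the first column of a diagram changes
-- the weight in a controlled way and replaces x by 1/x.
--   * C_m, for distinct parts ≤ m, satisfies C_m(x) = C_{m−1}(x) + x^[m odd] q^m C_{m−1}(1/x)
--     (remove a first row of length m); the sum over k satisfies the same recurrence by the
--     q-Pascal rules.
--   * A_m, for exactly m distinct parts, satisfies A_m(x) = q^m x^[m odd] (A_m(1/x) + A_{m−1}(1/x))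
--     (remove the first column), which determines A_m degree by degree; the product with the sum
--     over j satisfies it because (1 − q^{2j}) [i+j choose j] = (1 − q^{2(i+j)}) [i+j−1 choose j−1].
-- The generating function of the pairs is Σ_m A_m C_m.
module Submission where

open import Defs
open import Data.Nat using (ℕ)
open import Data.Integer using (ℤ; +_)
open import Data.Fin using (Fin)
open import Data.Product using (Σ; _×_)
open import Function.Bundles using (_↔_)
open import Relation.Binary.PropositionalEquality using (_≡_)

open import Algebra.Bundles using (CommutativeRing)
open import Algebra.Core using (Op₂)
import Algebra.Properties.Group
open import Algebra.Structures using (IsCommutativeRing)
open import Axiom.UniquenessOfIdentityProofs using (module Decidable⇒UIP)
open import Data.Bool using (if_then_else_)
open import Data.Bool.Properties using (T-≡)
open import Data.Fin using (zero; suc)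
open import Data.Integer as ℤ using (0ℤ; 1ℤ)
import Data.Integer.Properties as ℤₚ
open import Data.Integer.Tactic.RingSolver using (solve-∀)
open import Data.List using (List; []; _∷_; _++_; map; applyUpTo; zipWith; cartesianProduct; filter; length; lookup)
open import Data.List.Membership.Propositional using (_∈_)
open import Data.List.Membership.Propositional.Properties
import Data.List.Properties as Listₚ
open import Data.List.Relation.Binary.Disjoint.Propositional using (Disjoint)
open import Data.List.Relation.Unary.All as All using (All; []; _∷_)
open import Data.List.Relation.Unary.AllPairs using ([]; _∷_)
open import Data.List.Relation.Unary.Any using (here; index)
open import Data.List.Relation.Unary.Any.Properties using (lookup-index)
open import Data.List.Relation.Unary.Linked as Linked using (Linked; []; [-]; _∷_)
open import Data.List.Relation.Unary.Unique.Propositional using (Unique)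
import Data.List.Relation.Unary.Unique.Propositional.Properties as Unique
open import Data.Nat as ℕ using (zero; suc; z≤n; s≤s; _<_; _>_; _≤_)
open import Data.Nat.ListAction using (sum)
import Data.Nat.Properties as ℕₚ
import Data.Nat.Tactic.RingSolver as ℕ-RingSolver
open import Data.Product using (∃; _,_; proj₁; proj₂)
open import Data.Sum using (inj₁; inj₂)
open import Function using (id; _∘_)
open import Function.Bundles using (Equivalence; mk↔ₛ′)
open import Level using (0ℓ)
open import Relation.Binary.PropositionalEquality as ≡ using (cong; cong₂)
import Relation.Binary.Reasoning.Setoid as SetoidReasoning
open import Relation.Nullary using (¬_; yes; no; contradiction)
open import Relation.Nullary.Decidable using (isYes≗does; _×-dec_)
open import Relation.Unary using (Decidable)

-- Power series over a commutative ring

module AntidiagonalSum {c ℓ} (R : CommutativeRing c ℓ) where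
  open CommutativeRing R
  open SetoidReasoning setoid
  open import Algebra.Solver.Ring.NaturalCoefficients.Default commutativeSemiring

  -- S m F = Σ_{i+j=m} F i j
  S : ℕ → (ℕ → ℕ → Carrier) → Carrier
  S zero    F = F 0 0
  S (suc m) F = F 0 (suc m) + S m (λ i j → F (suc i) j)

  S-cong : ∀ m {F G} → (∀ i j → i ℕ.+ j ≡ m → F i j ≈ G i j) → S m F ≈ S m G
  S-cong zero    h = h 0 0 ≡.refl
  S-cong (suc m) h = +-cong (h 0 (suc m) ≡.refl) (S-cong m λ i j e → h (suc i) j (cong suc e))

  S-last : ∀ m F → S (suc m) F ≈ S m (λ i j → F i (suc j)) + F (suc m) 0
  S-last zero    F = refl
  S-last (suc m) F = begin
    F 0 (suc (suc m)) + S (suc m) (λ i j → F (suc i) j)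
      ≈⟨ +-congˡ (S-last m (λ i j → F (suc i) j)) ⟩
    F 0 (suc (suc m)) + (S m (λ i j → F (suc i) (suc j)) + F (suc (suc m)) 0)
      ≈⟨ +-assoc _ _ _ ⟨
    F 0 (suc (suc m)) + S m (λ i j → F (suc i) (suc j)) + F (suc (suc m)) 0 ∎

  S-flip : ∀ m F → S m F ≈ S m (λ i j → F j i)
  S-flip zero    F = refl
  S-flip (suc m) F = begin
    F 0 (suc m) + S m (λ i j → F (suc i) j) ≈⟨ +-congˡ (S-flip m _) ⟩
    F 0 (suc m) + S m (λ i j → F (suc j) i) ≈⟨ +-comm _ _ ⟩
    S m (λ i j → F (suc j) i) + F 0 (suc m) ≈⟨ S-last m (λ i j → F j i) ⟨
    S (suc m) (λ i j → F j i)               ∎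

  S-+ : ∀ m F G → S m (λ i j → F i j + G i j) ≈ S m F + S m G
  S-+ zero    F G = refl
  S-+ (suc m) F G = trans (+-congˡ (S-+ m _ _))
    (solve 4 (λ a b c d → (a :+ b) :+ (c :+ d) := (a :+ c) :+ (b :+ d)) refl _ _ _ _)

  S-*ˡ : ∀ m x F → x * S m F ≈ S m (λ i j → x * F i j)
  S-*ˡ zero    x F = refl
  S-*ˡ (suc m) x F = trans (distribˡ _ _ _) (+-congˡ (S-*ˡ m x _))

  S-*ʳ : ∀ m x F → S m F * x ≈ S m (λ i j → F i j * x)
  S-*ʳ zero    x F = refl
  S-*ʳ (suc m) x F = trans (distribʳ _ _ _) (+-congˡ (S-*ʳ m x _))

  S-zero : ∀ m {F} → (∀ i j → F i j ≈ 0#) → S m F ≈ 0#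
  S-zero zero    h = h 0 0
  S-zero (suc m) h = trans (+-cong (h _ _) (S-zero m λ i j → h (suc i) j)) (+-identityˡ 0#)

  -- Both sides run over all triples with `a + b + k = m`; the induction splits off the terms with
  -- `a = 0`.
  S-assoc : ∀ m (F : ℕ → ℕ → ℕ → Carrier) →
            S m (λ i k → S i (λ a b → F a b k)) ≈ S m (λ a j → S j (F a))
  S-assoc zero    F = refl
  S-assoc (suc m) F = begin
    F 0 0 (suc m) + S m (λ i k → F 0 (suc i) k + S i (λ a b → F (suc a) b k))
      ≈⟨ +-congˡ (S-+ m _ _) ⟩
    F 0 0 (suc m) + (S m (λ i k → F 0 (suc i) k) + S m (λ i k → S i (λ a b → F (suc a) b k)))
      ≈⟨ +-assoc _ _ _ ⟨
    S (suc m) (F 0) + S m (λ i k → S i (λ a b → F (suc a) b k))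
      ≈⟨ +-congˡ (S-assoc m (λ a → F (suc a))) ⟩
    S (suc m) (F 0) + S m (λ a j → S j (F (suc a))) ∎

module _ {c ℓ} (R : CommutativeRing c ℓ) where
  open CommutativeRing R
  open AntidiagonalSum R

  -- Product and unit are parameters known only through their coefficients, so the ring obtained has
  -- `_*ₛ_` and `sone` themselves as operations.
  module PowerSeries
    (_·_ : Op₂ (ℕ → Carrier))
    (·-coeff : ∀ f g N → (f · g) N ≈ S N (λ i j → f i * g j))
    (one : ℕ → Carrier)
    (one-zero : one 0 ≈ 1#)
    (one-suc : ∀ N → one (suc N) ≈ 0#)
    where

    record _≈ₛ_ (f g : ℕ → Carrier) : Set ℓ where
      constructor coeffwise
      field _at_ : ∀ N → f N ≈ g N
    open _≈ₛ_ public

    ·-cong : ∀ {f f′ g g′} → f ≈ₛ f′ → g ≈ₛ g′ → (f · g) ≈ₛ (f′ · g′)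
    ·-cong {f} {f′} {g} {g′} p q = coeffwise λ N → trans (·-coeff f g N)
      (trans (S-cong N λ i j _ → *-cong (p at i) (q at j)) (sym (·-coeff f′ g′ N)))

    ·-comm : ∀ f g → (f · g) ≈ₛ (g · f)
    ·-comm f g = coeffwise λ N → trans (·-coeff f g N) (trans (S-flip N _)
      (trans (S-cong N λ i j _ → *-comm _ _) (sym (·-coeff g f N))))

    ·-assoc : ∀ f g h → ((f · g) · h) ≈ₛ (f · (g · h))
    ·-assoc f g h = coeffwise λ N → begin
      ((f · g) · h) N                                ≈⟨ ·-coeff _ _ N ⟩
      S N (λ i k → (f · g) i * h k)                  ≈⟨ S-cong N (λ i k _ → *-congʳ (·-coeff f g i)) ⟩
      S N (λ i k → S i (λ a b → f a * g b) * h k)    ≈⟨ S-cong N (λ i k _ → S-*ʳ i _ _) ⟩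
      S N (λ i k → S i (λ a b → f a * g b * h k))    ≈⟨ S-assoc N (λ a b k → f a * g b * h k) ⟩
      S N (λ a j → S j (λ b k → f a * g b * h k))    ≈⟨ S-cong N (λ a j _ → S-cong j λ b k _ → *-assoc _ _ _) ⟩
      S N (λ a j → S j (λ b k → f a * (g b * h k)))  ≈⟨ S-cong N (λ a j _ → S-*ˡ j _ _) ⟨
      S N (λ a j → f a * S j (λ b k → g b * h k))    ≈⟨ S-cong N (λ a j _ → *-congˡ (·-coeff g h j)) ⟨
      S N (λ a j → f a * (g · h) j)                  ≈⟨ ·-coeff _ _ N ⟨
      (f · (g · h)) N                                ∎
      where open SetoidReasoning setoid

    ·-distribˡ : ∀ f g h → (f · (λ N → g N + h N)) ≈ₛ (λ N → (f · g) N + (f · h) N)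
    ·-distribˡ f g h = coeffwise λ N → trans (·-coeff _ _ N)
      (trans (S-cong N λ i j _ → distribˡ _ _ _)
      (trans (S-+ N _ _) (sym (+-cong (·-coeff f g N) (·-coeff f h N)))))

    ·-identityˡ : ∀ f → (one · f) ≈ₛ f
    ·-identityˡ f = coeffwise λ where
      zero    → trans (·-coeff _ _ 0) (trans (*-congʳ one-zero) (*-identityˡ _))
      (suc N) → trans (·-coeff _ _ (suc N))
        (trans (+-cong (trans (*-congʳ one-zero) (*-identityˡ _))
                       (S-zero N λ i j → trans (*-congʳ (one-suc i)) (zeroˡ _)))
               (+-identityʳ _))

    ≈ₛ-trans : ∀ {f g h} → f ≈ₛ g → g ≈ₛ h → f ≈ₛ h
    ≈ₛ-trans p q = coeffwise λ N → trans (p at N) (q at N)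

    series-isCommutativeRing : IsCommutativeRing _≈ₛ_ (λ f g N → f N + g N) _·_ (λ f N → - f N) (λ _ → 0#) one
    series-isCommutativeRing = record
      { isRing = record
        { +-isAbelianGroup = record
          { isGroup = record
            { isMonoid = record
              { isSemigroup = record
                { isMagma = record
                  { isEquivalence = record
                    { refl  = coeffwise λ _ → refl
                    ; sym   = λ p → coeffwise λ N → sym (p at N)
                    ; trans = ≈ₛ-trans
                    }
                  ; ∙-cong = λ p q → coeffwise λ N → +-cong (p at N) (q at N)
                  }
                ; assoc = λ f g h → coeffwise λ N → +-assoc (f N) (g N) (h N)
                }
              ; identity = (λ f → coeffwise λ N → +-identityˡ (f N)) , (λ f → coeffwise λ N → +-identityʳ (f N))
              }
            ; inverse = (λ f → coeffwise λ N → -‿inverseˡ (f N)) , (λ f → coeffwise λ N → -‿inverseʳ (f N))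
            ; ⁻¹-cong = λ p → coeffwise λ N → -‿cong (p at N)
            }
          ; comm = λ f g → coeffwise λ N → +-comm (f N) (g N)
          }
        ; *-cong = ·-cong
        ; *-assoc = ·-assoc
        ; *-identity = ·-identityˡ , (λ f → ≈ₛ-trans (·-comm f one) (·-identityˡ f))
        ; distrib = ·-distribˡ , λ f g h → ≈ₛ-trans (·-comm _ f) (≈ₛ-trans (·-distribˡ f g h)
            (coeffwise λ N → +-cong (·-comm f g at N) (·-comm f h at N)))
        }
      ; *-comm = ·-comm
      }

    series-commutativeRing : CommutativeRing c ℓ
    series-commutativeRing = record { isCommutativeRing = series-isCommutativeRing }

-- Laurent polynomials and the series ring of Defs

-- Pairing with all test functions φ, rather than only with the indicators that
-- coeffX uses, makes every ring law of Laurent polynomials a Fubini argument.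
⟨_,_⟩ : LPoly → (ℤ → ℤ) → ℤ
⟨ []          , φ ⟩ = 0ℤ
⟨ (e , c) ∷ p , φ ⟩ = c ℤ.* φ e ℤ.+ ⟨ p , φ ⟩

record _≈ₗ_ (p r : LPoly) : Set where
  constructor pairwise
  field _on_ : ∀ φ → ⟨ p , φ ⟩ ≡ ⟨ r , φ ⟩
open _≈ₗ_ public

pair-cong : ∀ p {φ ψ} → (∀ e → φ e ≡ ψ e) → ⟨ p , φ ⟩ ≡ ⟨ p , ψ ⟩
pair-cong []            h = ≡.refl
pair-cong ((e , c) ∷ p) h = cong₂ ℤ._+_ (cong (c ℤ.*_) (h e)) (pair-cong p h)

pair-++ : ∀ p r φ → ⟨ p ++ r , φ ⟩ ≡ ⟨ p , φ ⟩ ℤ.+ ⟨ r , φ ⟩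
pair-++ []            r φ = ≡.sym (ℤₚ.+-identityˡ _)
pair-++ ((e , c) ∷ p) r φ =
  ≡.trans (cong (λ z → c ℤ.* φ e ℤ.+ z) (pair-++ p r φ)) (≡.sym (ℤₚ.+-assoc (c ℤ.* φ e) _ _))

pair-neg : ∀ p φ → ⟨ lneg p , φ ⟩ ≡ ℤ.- ⟨ p , φ ⟩
pair-neg []            φ = ≡.refl
pair-neg ((e , c) ∷ p) φ = ≡.trans (cong (λ z → ℤ.- c ℤ.* φ e ℤ.+ z) (pair-neg p φ)) (lemma c (φ e) _)
  where
  lemma : ∀ c x y → ℤ.- c ℤ.* x ℤ.+ ℤ.- y ≡ ℤ.- (c ℤ.* x ℤ.+ y)
  lemma = solve-∀

pair-zero : ∀ p → ⟨ p , (λ _ → 0ℤ) ⟩ ≡ 0ℤ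
pair-zero []            = ≡.refl
pair-zero ((e , c) ∷ p) = cong₂ ℤ._+_ (ℤₚ.*-zeroʳ c) (pair-zero p)

pair-linear : ∀ p c φ ψ → ⟨ p , (λ e → c ℤ.* φ e ℤ.+ ψ e) ⟩ ≡ c ℤ.* ⟨ p , φ ⟩ ℤ.+ ⟨ p , ψ ⟩
pair-linear []            c φ ψ = ≡.sym (≡.trans (ℤₚ.+-identityʳ _) (ℤₚ.*-zeroʳ c))
pair-linear ((e , d) ∷ p) c φ ψ =
  ≡.trans (cong (λ z → d ℤ.* (c ℤ.* φ e ℤ.+ ψ e) ℤ.+ z) (pair-linear p c φ ψ)) (lemma d c (φ e) (ψ e) _ _)
  where
  lemma : ∀ d c x y u v → d ℤ.* (c ℤ.* x ℤ.+ y) ℤ.+ (c ℤ.* u ℤ.+ v) ≡ c ℤ.* (d ℤ.* x ℤ.+ u) ℤ.+ (d ℤ.* y ℤ.+ v)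
  lemma = solve-∀

-- Interchange of two finite sums. With `K e f = φ (e + f)` it yields the commutativity of `_⊗_`.
pair-swap : ∀ p r (K : ℤ → ℤ → ℤ) → ⟨ p , (λ e → ⟨ r , K e ⟩) ⟩ ≡ ⟨ r , (λ f → ⟨ p , (λ e → K e f) ⟩) ⟩
pair-swap []            r K = ≡.sym (pair-zero r)
pair-swap ((e , c) ∷ p) r K = ≡.trans (cong (λ z → c ℤ.* ⟨ r , K e ⟩ ℤ.+ z) (pair-swap p r K))
  (≡.sym (pair-linear r c (K e) _))

pair-⊗ : ∀ p r φ → ⟨ p ⊗ r , φ ⟩ ≡ ⟨ p , (λ e → ⟨ r , (λ f → φ (e ℤ.+ f)) ⟩) ⟩
pair-⊗ []            r φ = ≡.refl
pair-⊗ ((e , c) ∷ p) r φ = ≡.trans (pair-++ (map _ r) (p ⊗ r) φ) (cong₂ ℤ._+_ (scale r) (pair-⊗ p r φ))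
  where
  lemma : ∀ c d x u → (c ℤ.* d) ℤ.* x ℤ.+ c ℤ.* u ≡ c ℤ.* (d ℤ.* x ℤ.+ u)
  lemma = solve-∀
  scale : ∀ r → ⟨ map (λ { (f , d) → (e ℤ.+ f , c ℤ.* d) }) r , φ ⟩ ≡ c ℤ.* ⟨ r , (λ f → φ (e ℤ.+ f)) ⟩
  scale []            = ≡.sym (ℤₚ.*-zeroʳ c)
  scale ((f , d) ∷ r) = ≡.trans (cong (λ z → (c ℤ.* d) ℤ.* φ (e ℤ.+ f) ℤ.+ z) (scale r))
                                (lemma c d (φ (e ℤ.+ f)) _)

≈ₗ-trans : ∀ {p r t} → p ≈ₗ r → r ≈ₗ t → p ≈ₗ t
≈ₗ-trans h k = pairwise λ φ → ≡.trans (h on φ) (k on φ)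

⊗-comm : ∀ p r → (p ⊗ r) ≈ₗ (r ⊗ p)
⊗-comm p r = pairwise λ φ → ≡.trans (pair-⊗ p r φ) (≡.trans (pair-swap p r _)
  (≡.trans (pair-cong r λ f → pair-cong p λ e → cong φ (ℤₚ.+-comm e f)) (≡.sym (pair-⊗ r p φ))))

⊗-cong : ∀ {p p′ r r′} → p ≈ₗ p′ → r ≈ₗ r′ → (p ⊗ r) ≈ₗ (p′ ⊗ r′)
⊗-cong {p} {p′} {r} {r′} h k = pairwise λ φ → ≡.trans (pair-⊗ p r φ)
  -- The inner pairing over `r′` is, as a function of `e`, again a test function, so `h` applies to
  -- it.
  (≡.trans (pair-cong p λ e → k on _) (≡.trans (h on _) (≡.sym (pair-⊗ p′ r′ φ))))

⊗-assoc : ∀ p r t → ((p ⊗ r) ⊗ t) ≈ₗ (p ⊗ (r ⊗ t))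
⊗-assoc p r t = pairwise λ φ → begin
  ⟨ (p ⊗ r) ⊗ t , φ ⟩
    ≡⟨ pair-⊗ (p ⊗ r) t φ ⟩
  ⟨ p ⊗ r , (λ e → ⟨ t , (λ g → φ (e ℤ.+ g)) ⟩) ⟩
    ≡⟨ pair-⊗ p r _ ⟩
  ⟨ p , (λ e → ⟨ r , (λ f → ⟨ t , (λ g → φ ((e ℤ.+ f) ℤ.+ g)) ⟩) ⟩) ⟩
    ≡⟨ pair-cong p (λ e → pair-cong r λ f → pair-cong t λ g → cong φ (ℤₚ.+-assoc e f g)) ⟩
  ⟨ p , (λ e → ⟨ r , (λ f → ⟨ t , (λ g → φ (e ℤ.+ (f ℤ.+ g))) ⟩) ⟩) ⟩
    ≡⟨ pair-cong p (λ e → pair-⊗ r t _) ⟨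
  ⟨ p , (λ e → ⟨ r ⊗ t , (λ f → φ (e ℤ.+ f)) ⟩) ⟩
    ≡⟨ pair-⊗ p (r ⊗ t) φ ⟨
  ⟨ p ⊗ (r ⊗ t) , φ ⟩ ∎
  where open ≡.≡-Reasoning

⊗-identityˡ : ∀ p → (lone ⊗ p) ≈ₗ p
⊗-identityˡ p = pairwise λ φ → ≡.trans (pair-⊗ lone p φ) (≡.trans (ℤₚ.+-identityʳ _)
  (≡.trans (ℤₚ.*-identityˡ _) (pair-cong p λ e → cong φ (ℤₚ.+-identityˡ e))))

⊗-distribˡ : ∀ p r t → (p ⊗ (r ⊕ t)) ≈ₗ ((p ⊗ r) ⊕ (p ⊗ t))
⊗-distribˡ p r t = pairwise λ φ →
  let ρ = λ e → ⟨ r , (λ f → φ (e ℤ.+ f)) ⟩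
      τ = λ e → ⟨ t , (λ f → φ (e ℤ.+ f)) ⟩
  in begin
  ⟨ p ⊗ (r ⊕ t) , φ ⟩                        ≡⟨ pair-⊗ p (r ⊕ t) φ ⟩
  ⟨ p , (λ e → ⟨ r ⊕ t , (λ f → φ (e ℤ.+ f)) ⟩) ⟩
    ≡⟨ pair-cong p (λ e → ≡.trans (pair-++ r t _) (cong (ℤ._+ τ e) (≡.sym (ℤₚ.*-identityˡ (ρ e))))) ⟩
  ⟨ p , (λ e → 1ℤ ℤ.* ρ e ℤ.+ τ e) ⟩         ≡⟨ pair-linear p 1ℤ ρ τ ⟩
  1ℤ ℤ.* ⟨ p , ρ ⟩ ℤ.+ ⟨ p , τ ⟩             ≡⟨ cong (ℤ._+ ⟨ p , τ ⟩) (ℤₚ.*-identityˡ ⟨ p , ρ ⟩) ⟩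
  ⟨ p , ρ ⟩ ℤ.+ ⟨ p , τ ⟩                     ≡⟨ cong₂ ℤ._+_ (pair-⊗ p r φ) (pair-⊗ p t φ) ⟨
  ⟨ p ⊗ r , φ ⟩ ℤ.+ ⟨ p ⊗ t , φ ⟩            ≡⟨ pair-++ (p ⊗ r) (p ⊗ t) φ ⟨
  ⟨ (p ⊗ r) ⊕ (p ⊗ t) , φ ⟩                  ∎
  where open ≡.≡-Reasoning

⊕-cong : ∀ {p p′ r r′} → p ≈ₗ p′ → r ≈ₗ r′ → (p ⊕ r) ≈ₗ (p′ ⊕ r′)
⊕-cong {p} {p′} {r} {r′} h k = pairwise λ φ →
  ≡.trans (pair-++ p r φ) (≡.trans (cong₂ ℤ._+_ (h on φ) (k on φ)) (≡.sym (pair-++ p′ r′ φ)))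

⊕-comm : ∀ p r → (p ⊕ r) ≈ₗ (r ⊕ p)
⊕-comm p r = pairwise λ φ →
  ≡.trans (pair-++ p r φ) (≡.trans (ℤₚ.+-comm ⟨ p , φ ⟩ _) (≡.sym (pair-++ r p φ)))

⊕-inverseˡ : ∀ p → (lneg p ⊕ p) ≈ₗ lzero
⊕-inverseˡ p = pairwise λ φ →
  ≡.trans (pair-++ (lneg p) p φ) (≡.trans (cong (ℤ._+ ⟨ p , φ ⟩) (pair-neg p φ)) (ℤₚ.+-inverseˡ ⟨ p , φ ⟩))

LPoly-isCommutativeRing : IsCommutativeRing _≈ₗ_ _⊕_ _⊗_ lneg lzero lone
LPoly-isCommutativeRing = record
  { isRing = record
    { +-isAbelianGroup = record
      { isGroup = record
        { isMonoid = record
          { isSemigroup = record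
            { isMagma = record
              { isEquivalence = record
                { refl  = pairwise λ _ → ≡.refl
                ; sym   = λ h → pairwise λ φ → ≡.sym (h on φ)
                ; trans = ≈ₗ-trans
                }
              ; ∙-cong = ⊕-cong
              }
            ; assoc = λ p r t → pairwise λ φ → cong ⟨_, φ ⟩ (Listₚ.++-assoc p r t)
            }
          ; identity = (λ p → pairwise λ φ → ≡.refl) , (λ p → pairwise λ φ → cong ⟨_, φ ⟩ (Listₚ.++-identityʳ p))
          }
        ; inverse = ⊕-inverseˡ , (λ p → ≈ₗ-trans (⊕-comm p (lneg p)) (⊕-inverseˡ p))
        ; ⁻¹-cong = λ {p} {r} h → pairwise λ φ →
            ≡.trans (pair-neg p φ) (≡.trans (cong ℤ.-_ (h on φ)) (≡.sym (pair-neg r φ)))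
        }
      ; comm = ⊕-comm
      }
    ; *-cong = ⊗-cong
    ; *-assoc = ⊗-assoc
    ; *-identity = ⊗-identityˡ , (λ p → ≈ₗ-trans (⊗-comm p lone) (⊗-identityˡ p))
    ; distrib = ⊗-distribˡ , λ p r t → ≈ₗ-trans (⊗-comm _ p) (≈ₗ-trans (⊗-distribˡ p r t)
        (⊕-cong (⊗-comm p r) (⊗-comm p t)))
    }
  ; *-comm = ⊗-comm
  }

LPoly-commutativeRing : CommutativeRing 0ℓ 0ℓ
LPoly-commutativeRing = record { isCommutativeRing = LPoly-isCommutativeRing }

module L where
  open CommutativeRing LPoly-commutativeRing public
  open AntidiagonalSum LPoly-commutativeRing public

lsum-antidiagonal : ∀ N (F : ℕ → ℕ → LPoly) →
  lsum (applyUpTo (λ i → F i (N ℕ.∸ i)) (suc N)) L.≈ L.S N F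
lsum-antidiagonal zero    F = L.+-identityʳ _
lsum-antidiagonal (suc N) F = L.+-congˡ (lsum-antidiagonal N (λ i j → F (suc i) j))

*ₛ-coeff : ∀ f g N → (f *ₛ g) N L.≈ L.S N (λ i j → f i ⊗ g j)
*ₛ-coeff f g N = L.trans
  (L.reflexive (cong lsum (Listₚ.map-applyUpTo id (λ i → f i ⊗ g (N ℕ.∸ i)) (suc N))))
  (lsum-antidiagonal N (λ i j → f i ⊗ g j))

module Q where
  open PowerSeries LPoly-commutativeRing _*ₛ_ *ₛ-coeff sone L.refl (λ _ → L.refl) public
    using (coeffwise; _at_; series-commutativeRing)
  open CommutativeRing series-commutativeRing public
  open AntidiagonalSum series-commutativeRing public

-- `invRev f N` lists the coefficients of the inverse from degree `N` down to 0, so zipping it with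
-- indices gives an antidiagonal sum. The induction replaces `s` by `s ∘ suc`, hence the general
-- `s`.
invRev-sum : ∀ f N (s : ℕ → ℕ) →
  lsum (zipWith (λ i g → f (suc i) ⊗ g) (applyUpTo s (suc N)) (invRev f N))
    L.≈ L.S N (λ i j → f (suc (s i)) ⊗ inv f j)
invRev-sum f zero    s = L.+-identityʳ _
invRev-sum f (suc N) s = L.+-congˡ (invRev-sum f N (s ∘ suc))

-- In degree `suc N` the term with `i = 0` is the new coefficient of the inverse, which was defined
-- as minus the sum of the others.
inv-inverseʳ : ∀ f → f 0 L.≈ lone → (f *ₛ inv f) Q.≈ sone
inv-inverseʳ f f0 = Q.coeffwise λ where
  zero    → L.trans (*ₛ-coeff f (inv f) 0) (L.trans (L.*-congʳ f0) (L.*-identityˡ lone))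
  (suc N) → L.trans (*ₛ-coeff f (inv f) (suc N)) (L.trans
    (L.+-congʳ (L.trans (L.*-congʳ f0) (L.trans (L.*-identityˡ _) (L.-‿cong (invRev-sum f N id)))))
    (L.-‿inverseˡ (L.S N (λ i j → f (suc i) ⊗ inv f j))))

mono-suc : ∀ a n N → mono a (+ suc n) (suc N) ≡ mono a (+ n) N
mono-suc a n N = cong (λ b → if b then (a , 1ℤ) ∷ [] else [])
  -- The `does` fields of the two comparisons reduce to the same Boolean test.
  (≡.trans (isYes≗does (+ suc N ℤ.≟ + suc n)) (≡.sym (isYes≗does (+ N ℤ.≟ + n))))

-- Each factor q shifts coefficients by one degree, so induction on `m` reduces to `m = 0`, where
-- the left factor has only a constant coefficient.
mono-* : ∀ a b m n → (mono a (+ m) *ₛ mono b (+ n)) Q.≈ mono (a ℤ.+ b) (+ (m ℕ.+ n))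
mono-* a b m n = Q.coeffwise λ N → L.trans (*ₛ-coeff (mono a (+ m)) (mono b (+ n)) N) (coeff m N)
  where
  tail-zero : ∀ N → L.S N (λ i j → mono a (+ 0) (suc i) ⊗ mono b (+ n) j) L.≈ lzero
  tail-zero N = L.S-zero N (λ i j → L.refl)

  head : ∀ N → (((a , 1ℤ) ∷ []) ⊗ mono b (+ n) N) L.≈ mono (a ℤ.+ b) (+ n) N
  head N with (+ N) ℤ.≟ (+ n)
  ... | yes _ = L.refl
  ... | no _  = L.refl

  coeff : ∀ m N → L.S N (λ i j → mono a (+ m) i ⊗ mono b (+ n) j) L.≈ mono (a ℤ.+ b) (+ (m ℕ.+ n)) N
  coeff zero    zero    = head 0
  coeff zero    (suc N) = L.trans (L.+-cong (head (suc N)) (tail-zero N)) (L.+-identityʳ _)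
  coeff (suc m) zero    = L.refl
  coeff (suc m) (suc N) = L.trans
    (L.S-cong N λ i j _ → L.*-congʳ (L.reflexive (mono-suc a m i)))
    (L.trans (coeff m N) (L.reflexive (≡.sym (mono-suc _ (m ℕ.+ n) N))))

-- Exponents

parity : ℕ → ℤ
parity zero    = 0ℤ
parity (suc m) = 1ℤ ℤ.- parity m

-- The additive form of (-1)^m = 1 - 2[m odd], by which `sgn` and `parity` are exchanged.
parity-sgn : ∀ m → parity m ℤ.+ parity m ℤ.+ sgn m ≡ 1ℤ
parity-sgn zero    = ≡.refl
parity-sgn (suc m) = ≡.trans (lemma (parity m) (sgn m)) (cong (λ z → 1ℤ ℤ.+ (1ℤ ℤ.- z)) (parity-sgn m))
  where
  lemma : ∀ p s → (1ℤ ℤ.- p) ℤ.+ (1ℤ ℤ.- p) ℤ.+ ℤ.- s ≡ 1ℤ ℤ.+ (1ℤ ℤ.- (p ℤ.+ p ℤ.+ s))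
  lemma = solve-∀

-- Recursive, so that `double (suc n)` reduces to two successors and inductions can pass from 2n
-- through 2n+1 to 2n+2.
double : ℕ → ℕ
double zero    = 0
double (suc n) = suc (suc (double n))

double-+ : ∀ n → double n ≡ n ℕ.+ n
double-+ zero    = ≡.refl
double-+ (suc n) = cong suc (≡.trans (cong suc (double-+ n)) (≡.sym (ℕₚ.+-suc n n)))

parity-double : ∀ n → parity (double n) ≡ 0ℤ
parity-double zero    = ≡.refl
parity-double (suc n) = cong (λ z → 1ℤ ℤ.- (1ℤ ℤ.- z)) (parity-double n)

-- The least size of a partition into `m` distinct positive parts.
triangle : ℕ → ℕ
triangle zero    = 0
triangle (suc m) = suc m ℕ.+ triangle m

-- 2k² − k, the exponent in kmono
expo : ℤ → ℕ
expo k = ℤ.∣ + 2 ℤ.* (k ℤ.* k) ℤ.- k ∣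

-- 2k² - k = k(2k - 1) is never negative: for nonzero k it is rewritten, by the sign of k, as a
-- product of two natural numbers.
expo-+ : ∀ k → + expo k ≡ + 2 ℤ.* (k ℤ.* k) ℤ.- k
expo-+ k = ℤₚ.0≤i⇒+∣i∣≡i (nonneg k)
  where
  lemma₁ : ∀ z → (1ℤ ℤ.+ z) ℤ.* (1ℤ ℤ.+ (z ℤ.+ z)) ≡ + 2 ℤ.* ((1ℤ ℤ.+ z) ℤ.* (1ℤ ℤ.+ z)) ℤ.- (1ℤ ℤ.+ z)
  lemma₁ = solve-∀
  lemma₂ : ∀ z → z ℤ.* (1ℤ ℤ.+ (z ℤ.+ z)) ≡ + 2 ℤ.* (ℤ.- z ℤ.* ℤ.- z) ℤ.- ℤ.- z
  lemma₂ = solve-∀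
  product : ∀ m n → 0ℤ ℤ.≤ + m ℤ.* + n
  product m n = ≡.subst (0ℤ ℤ.≤_) (ℤₚ.pos-* m n) (ℤ.+≤+ ℕ.z≤n)
  nonneg : ∀ k → 0ℤ ℤ.≤ + 2 ℤ.* (k ℤ.* k) ℤ.- k
  nonneg (+ zero)    = ℤₚ.≤-refl
  nonneg (+ suc n)   = ≡.subst (0ℤ ℤ.≤_) (lemma₁ (+ n)) (product (suc n) (suc (n ℕ.+ n)))
  nonneg ℤ.-[1+ n ]  = ≡.subst (0ℤ ℤ.≤_) (lemma₂ (+ suc n)) (product (suc n) (suc (suc n ℕ.+ suc n)))

-- ε (2n) i = i − n and ε (2n+1) i = n + 1 − i
ε : ℕ → ℕ → ℤ
ε zero    i = + i
ε (suc m) i = parity (suc m) ℤ.- ε m i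

-- `ε m` is affine with slope (-1)^m, so the sum depends on `i + j` only. Arbitrary `i` and `j` are
-- allowed because the induction lowers `m` while keeping both.
ε-sum : ∀ m i j → ε m i ℤ.+ ε m j ≡ parity m ℤ.+ sgn m ℤ.* (+ (i ℕ.+ j) ℤ.- + m)
ε-sum zero    i j = lemma (+ i) (+ j)
  where
  lemma : ∀ x y → x ℤ.+ y ≡ 0ℤ ℤ.+ 1ℤ ℤ.* (x ℤ.+ y ℤ.- 0ℤ)
  lemma = solve-∀
ε-sum (suc m) i j = begin
  (p′ ℤ.- ε m i) ℤ.+ (p′ ℤ.- ε m j)          ≡⟨ lemma₁ p (ε m i) (ε m j) ⟩
  -- The leading 1 is isolated so that `parity-sgn` can replace it by `p + p + sgn m`, after which
  -- `p + p` cancels.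
  (1ℤ ℤ.- (p ℤ.+ p) ℤ.+ 1ℤ) ℤ.- (ε m i ℤ.+ ε m j)     ≡⟨ cong₂ (λ u v → (u ℤ.- (p ℤ.+ p) ℤ.+ 1ℤ) ℤ.- v) (≡.sym (parity-sgn m)) (ε-sum m i j) ⟩
  (p ℤ.+ p ℤ.+ sgn m ℤ.- (p ℤ.+ p) ℤ.+ 1ℤ) ℤ.- (p ℤ.+ sgn m ℤ.* (+ (i ℕ.+ j) ℤ.- + m))
    ≡⟨ lemma₂ p (sgn m) (+ (i ℕ.+ j)) (+ m) ⟩
  p′ ℤ.+ ℤ.- sgn m ℤ.* (+ (i ℕ.+ j) ℤ.- + suc m) ∎
  where
  open ≡.≡-Reasoning
  p  = parity m
  p′ = parity (suc m)
  lemma₁ : ∀ p x y → ((1ℤ ℤ.- p) ℤ.- x) ℤ.+ ((1ℤ ℤ.- p) ℤ.- y) ≡ (1ℤ ℤ.- (p ℤ.+ p) ℤ.+ 1ℤ) ℤ.- (x ℤ.+ y)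
  lemma₁ = solve-∀
  lemma₂ : ∀ p s t m → (p ℤ.+ p ℤ.+ s ℤ.- (p ℤ.+ p) ℤ.+ 1ℤ) ℤ.- (p ℤ.+ s ℤ.* (t ℤ.- m))
                      ≡ (1ℤ ℤ.- p) ℤ.+ ℤ.- s ℤ.* (t ℤ.- (1ℤ ℤ.+ m))
  lemma₂ = solve-∀

ε-reflect : ∀ {m} i j → i ℕ.+ j ≡ m → ε m i ≡ parity m ℤ.- ε m j
ε-reflect {m} i j ≡.refl = begin
  ε m i                                          ≡⟨ lemma₁ (ε m i) (ε m j) ⟩
  (ε m i ℤ.+ ε m j) ℤ.- ε m j                    ≡⟨ cong (ℤ._- ε m j) (ε-sum m i j) ⟩
  parity m ℤ.+ sgn m ℤ.* (+ m ℤ.- + m) ℤ.- ε m j ≡⟨ lemma₂ (parity m) (sgn m) (+ m) (ε m j) ⟩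
  parity m ℤ.- ε m j                             ∎
  where
  open ≡.≡-Reasoning
  lemma₁ : ∀ x y → x ≡ (x ℤ.+ y) ℤ.- y
  lemma₁ = solve-∀
  lemma₂ : ∀ p s m y → p ℤ.+ s ℤ.* (m ℤ.- m) ℤ.- y ≡ p ℤ.- y
  lemma₂ = solve-∀

-- Closed forms and their recurrences

solve-summand : ∀ {i j k} → i ℕ.+ j ≡ k → + i ≡ + k ℤ.- + j
solve-summand {i} {j} ≡.refl = lemma (+ i) (+ j)
  where
  lemma : ∀ i j → i ≡ i ℤ.+ j ℤ.- j
  lemma = solve-∀

module _ {c ℓ} (R : CommutativeRing c ℓ) where
  open CommutativeRing R
  open AntidiagonalSum R
  open SetoidReasoning setoid
  open import Algebra.Solver.Ring.NaturalCoefficients.Default commutativeSemiring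
    using (solve; _:*_; _:+_; _:=_)

  module ClosedForms
    -- X a n stands for x^a q^n
    (X : ℤ → ℕ → Carrier)
    (X-* : ∀ a b m n → X a m * X b n ≈ X (a ℤ.+ b) (m ℕ.+ n))
    (X-one : X 0ℤ 0 ≈ 1#)
    (poch ipoch : ℕ → Carrier)
    (poch-zero : poch 0 ≈ 1#)
    (poch-suc : ∀ m → poch (suc m) ≈ poch m * (1# + - X 0ℤ (2 ℕ.* suc m)))
    (poch-inverse : ∀ m → poch m * ipoch m ≈ 1#)
    where

    X-cong : ∀ {a b m n} → a ≡ b → m ≡ n → X a m ≈ X b n
    X-cong ≡.refl ≡.refl = refl

    q²^ : ℕ → Carrier
    q²^ m = X 0ℤ (2 ℕ.* m)

    d : ℕ → Carrier
    d m = 1# + - q²^ m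

    d+q² : ∀ m → d m + q²^ m ≈ 1#
    d+q² m = trans (+-assoc _ _ _) (trans (+-congˡ (-‿inverseˡ _)) (+-identityʳ _))

    q²-+ : ∀ a b → q²^ a * q²^ b ≈ q²^ (a ℕ.+ b)
    q²-+ a b = trans (X-* _ _ _ _) (X-cong ≡.refl (≡.sym (ℕₚ.*-distribˡ-+ 2 a b)))

    -- This is 1 - uv = (1 - u) + u(1 - v). Adding uv to both sides removes the negations and leaves
    -- an identity of commutative semirings.
    d-+ : ∀ a b → d (a ℕ.+ b) ≈ d a + q²^ a * d b
    d-+ a b = Algebra.Properties.Group.∙-cancelʳ +-group (q²^ (a ℕ.+ b)) _ _ (begin
      d (a ℕ.+ b) + q²^ (a ℕ.+ b)          ≈⟨ d+q² (a ℕ.+ b) ⟩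
      1#                                   ≈⟨ d+q² a ⟨
      d a + q²^ a                          ≈⟨ +-congˡ (*-identityʳ _) ⟨
      d a + q²^ a * 1#                     ≈⟨ +-congˡ (*-congˡ (d+q² b)) ⟨
      d a + q²^ a * (d b + q²^ b)          ≈⟨ solve 4 (λ x y z w → x :+ y :* (z :+ w) := x :+ y :* z :+ y :* w) refl _ _ _ _ ⟩
      d a + q²^ a * d b + q²^ a * q²^ b    ≈⟨ +-congˡ (q²-+ a b) ⟩
      d a + q²^ a * d b + q²^ (a ℕ.+ b)    ∎)

    ipoch-suc : ∀ m → d (suc m) * ipoch (suc m) ≈ ipoch m
    ipoch-suc m = begin
      d (suc m) * ipoch (suc m)                        ≈⟨ *-identityˡ _ ⟨
      1# * (d (suc m) * ipoch (suc m))                 ≈⟨ *-congʳ (poch-inverse m) ⟨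
      poch m * ipoch m * (d (suc m) * ipoch (suc m))   ≈⟨ solve 4 (λ x y z w → x :* y :* (z :* w) := y :* (x :* z :* w)) refl _ _ _ _ ⟩
      ipoch m * (poch m * d (suc m) * ipoch (suc m))   ≈⟨ *-congˡ (*-congʳ (poch-suc m)) ⟨
      ipoch m * (poch (suc m) * ipoch (suc m))         ≈⟨ *-congˡ (poch-inverse (suc m)) ⟩
      ipoch m * 1#                                     ≈⟨ *-identityʳ _ ⟩
      ipoch m                                          ∎

    ipoch-zero : ipoch 0 ≈ 1#
    ipoch-zero = trans (sym (*-identityˡ _)) (trans (*-congʳ (sym poch-zero)) (poch-inverse 0))

    -- B i j is the q²-binomial coefficient [i+j choose i].
    B : ℕ → ℕ → Carrier
    B i j = poch (i ℕ.+ j) * ipoch i * ipoch j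

    B-sym : ∀ i j → B i j ≈ B j i
    B-sym i j = trans (*-congʳ (*-congʳ (reflexive (cong poch (ℕₚ.+-comm i j)))))
      (solve 3 (λ x y z → x :* y :* z := x :* z :* y) refl _ _ _)

    -- B i (j − 1) and B (i − 1) j, with the convention that B vanishes at −1
    B⁻ʳ B⁻ˡ : ℕ → ℕ → Carrier
    B⁻ʳ i zero    = 0#
    B⁻ʳ i (suc j) = B i j
    B⁻ˡ i j = B⁻ʳ j i

    -- The last factor of `poch (i + j)` is pulled out and `d j` cancels the last factor of the
    -- denominator `poch j`. For `j = 0` both sides vanish, since `d 0` is 1 - 1.
    absorb : ∀ i j → d j * B i j ≈ d (i ℕ.+ j) * B⁻ʳ i j
    absorb i zero = begin
      d 0 * B i 0      ≈⟨ *-congʳ (trans (+-congʳ (sym X-one)) (-‿inverseʳ _)) ⟩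
      0# * B i 0       ≈⟨ zeroˡ _ ⟩
      0#               ≈⟨ zeroʳ _ ⟨
      d (i ℕ.+ 0) * 0# ∎
    absorb i (suc j) = begin
      d (suc j) * (poch (i ℕ.+ suc j) * ipoch i * ipoch (suc j))
        ≈⟨ *-congˡ (*-congʳ (*-congʳ (trans (reflexive (cong poch (ℕₚ.+-suc i j))) (poch-suc (i ℕ.+ j))))) ⟩
      d (suc j) * (poch (i ℕ.+ j) * d (suc (i ℕ.+ j)) * ipoch i * ipoch (suc j))
        ≈⟨ solve 5 (λ x p y u v → x :* (p :* y :* u :* v) := y :* (p :* u :* (x :* v))) refl _ _ _ _ _ ⟩
      d (suc (i ℕ.+ j)) * (poch (i ℕ.+ j) * ipoch i * (d (suc j) * ipoch (suc j)))
        ≈⟨ *-cong (reflexive (cong d (≡.sym (ℕₚ.+-suc i j)))) (*-congˡ (ipoch-suc j)) ⟩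
      d (i ℕ.+ suc j) * B i j ∎

    absorbˡ : ∀ i j → d i * B i j ≈ d (i ℕ.+ j) * B⁻ˡ i j
    absorbˡ i j = trans (*-congˡ (B-sym i j)) (trans (absorb j i) (*-congʳ (reflexive (cong d (ℕₚ.+-comm j i)))))

    -- Every d (suc m) is a unit, so the Pascal rules may be checked after multiplication by it.
    d-cancel : ∀ m {x y} → d (suc m) * x ≈ d (suc m) * y → x ≈ y
    d-cancel m {x} {y} h = trans (sym (expand x)) (trans (*-congˡ h) (expand y))
      where
      unit : poch m * ipoch (suc m) * d (suc m) ≈ 1#
      unit = trans (solve 3 (λ x y z → x :* y :* z := x :* z :* y) refl _ _ _)
        (trans (*-congʳ (sym (poch-suc m))) (poch-inverse (suc m)))
      expand : ∀ x → poch m * ipoch (suc m) * (d (suc m) * x) ≈ x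
      expand x = trans (sym (*-assoc _ _ _)) (trans (*-congʳ unit) (*-identityˡ x))

    -- Multiplied by `d (i + j)`, the rule comes from splitting that factor by `d-+` and absorbing
    -- `d i` and `d j` separately.
    pascal : ∀ {m} i j → i ℕ.+ j ≡ suc m → B i j ≈ B⁻ˡ i j + q²^ i * B⁻ʳ i j
    pascal {m} i j e = d-cancel m (begin
      d (suc m) * B i j                              ≈⟨ *-congʳ (reflexive (cong d (≡.sym e))) ⟩
      d (i ℕ.+ j) * B i j                            ≈⟨ *-congʳ (d-+ i j) ⟩
      (d i + q²^ i * d j) * B i j                    ≈⟨ solve 4 (λ x y z w → (x :+ y :* z) :* w := x :* w :+ y :* (z :* w)) refl _ _ _ _ ⟩
      d i * B i j + q²^ i * (d j * B i j)            ≈⟨ +-cong (absorbˡ i j) (*-congˡ (absorb i j)) ⟩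
      d (i ℕ.+ j) * B⁻ˡ i j + q²^ i * (d (i ℕ.+ j) * B⁻ʳ i j)
        ≈⟨ solve 4 (λ x y z w → x :* y :+ z :* (x :* w) := x :* (y :+ z :* w)) refl _ _ _ _ ⟩
      d (i ℕ.+ j) * (B⁻ˡ i j + q²^ i * B⁻ʳ i j)     ≈⟨ *-congʳ (reflexive (cong d e)) ⟩
      d (suc m) * (B⁻ˡ i j + q²^ i * B⁻ʳ i j)       ∎)

    pascal′ : ∀ {m} i j → i ℕ.+ j ≡ suc m → B i j ≈ B⁻ʳ i j + q²^ j * B⁻ˡ i j
    pascal′ i j e = trans (B-sym i j) (pascal j i (≡.trans (ℕₚ.+-comm j i) e))

    -- The term with `j = 0` vanishes by the convention for `B⁻ʳ`, and the others are reindexed.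
    S-dropʳ : ∀ m (F : ℕ → ℕ → Carrier) → S (suc m) (λ i j → F i j * B⁻ʳ i j) ≈ S m (λ i j → F i (suc j) * B i j)
    S-dropʳ m F = trans (S-last m (λ i j → F i j * B⁻ʳ i j)) (trans (+-congˡ (zeroʳ _)) (+-identityʳ _))

    S-dropˡ : ∀ m (F : ℕ → ℕ → Carrier) → S (suc m) (λ i j → F i j * B⁻ˡ i j) ≈ S m (λ i j → F (suc i) j * B i j)
    S-dropˡ m F = trans (+-cong (zeroʳ _) (S-cong m λ i j _ → *-congˡ (B-sym j i))) (+-identityˡ _)

    -- The two Pascal rules put the power of q on different halves: here on the unshifted one, as
    -- `D-even` requires, and in `S-pascal′` on the shifted one, as `D-odd` requires.
    S-pascal : ∀ m (F : ℕ → Carrier) → S (suc m) (λ i j → F i * B i j)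
      ≈ S m (λ i j → F (suc i) * B i j) + S m (λ i j → F i * q²^ i * B i j)
    S-pascal m F = begin
      S (suc m) (λ i j → F i * B i j)
        ≈⟨ S-cong (suc m) (λ i j e → trans (*-congˡ (pascal i j e))
             (solve 4 (λ k x y z → k :* (x :+ y :* z) := k :* x :+ k :* y :* z) refl (F i) (B⁻ˡ i j) (q²^ i) (B⁻ʳ i j))) ⟩
      S (suc m) (λ i j → F i * B⁻ˡ i j + F i * q²^ i * B⁻ʳ i j)
        ≈⟨ S-+ (suc m) (λ i j → F i * B⁻ˡ i j) (λ i j → F i * q²^ i * B⁻ʳ i j) ⟩
      S (suc m) (λ i j → F i * B⁻ˡ i j) + S (suc m) (λ i j → F i * q²^ i * B⁻ʳ i j)
        ≈⟨ +-cong (S-dropˡ m (λ i j → F i)) (S-dropʳ m (λ i j → F i * q²^ i)) ⟩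
      S m (λ i j → F (suc i) * B i j) + S m (λ i j → F i * q²^ i * B i j) ∎

    S-pascal′ : ∀ m (F : ℕ → Carrier) → S (suc m) (λ i j → F i * B i j)
      ≈ S m (λ i j → F i * B i j) + S m (λ i j → F (suc i) * q²^ j * B i j)
    S-pascal′ m F = begin
      S (suc m) (λ i j → F i * B i j)
        ≈⟨ S-cong (suc m) (λ i j e → trans (*-congˡ (pascal′ i j e))
             (solve 4 (λ k x y z → k :* (x :+ y :* z) := k :* x :+ k :* y :* z) refl (F i) (B⁻ʳ i j) (q²^ j) (B⁻ˡ i j))) ⟩
      S (suc m) (λ i j → F i * B⁻ʳ i j + F i * q²^ j * B⁻ˡ i j)
        ≈⟨ S-+ (suc m) (λ i j → F i * B⁻ʳ i j) (λ i j → F i * q²^ j * B⁻ˡ i j) ⟩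
      S (suc m) (λ i j → F i * B⁻ʳ i j) + S (suc m) (λ i j → F i * q²^ j * B⁻ˡ i j)
        ≈⟨ +-cong (S-dropʳ m (λ i j → F i)) (S-dropˡ m (λ i j → F i * q²^ j)) ⟩
      S m (λ i j → F i * B i j) + S m (λ i j → F (suc i) * q²^ j * B i j) ∎

    -- By the symmetry of `B` the sum can be read backwards, which is how x turns into 1/x in the
    -- recurrences.
    scale-flip : ∀ m x (F : ℕ → Carrier) → x * S m (λ i j → F i * B i j) ≈ S m (λ i j → x * F j * B i j)
    scale-flip m x F = trans (*-congˡ (S-flip m _)) (trans (S-*ˡ m x _)
      (S-cong m λ i j _ → trans (sym (*-assoc _ _ _)) (*-congˡ (B-sym j i))))

    -- The generating functions below carry the sign s of the first row: a row of
    -- length l contributes x^(s · parity l), and the sign alternates between rows.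
    -- C m counts by largest part ≤ m and has closed form D; G M m counts by exactly m
    -- parts, all ≤ M, and has the closed form H in the limit M → ∞.

    κ : ℤ → ℤ → Carrier
    κ s k = X (s ℤ.* k) (expo k)

    -- The sum over k of the theorem with `i` = n + k. The shift `n` is a separate argument because
    -- `m` is either 2n or 2n+1.
    D : ℕ → ℕ → ℤ → Carrier
    D m n s = S m (λ i j → κ s (+ i ℤ.- + n) * B i j)

    -- The exponents of q are compared over the integers, where the condition is a ring identity;
    -- `expo-+` brings it back to natural numbers.
    κ-step : ∀ s t k k′ l m → s ℤ.* k ≡ t ℤ.+ ℤ.- s ℤ.* k′ →
             + 2 ℤ.* (k ℤ.* k) ℤ.- k ℤ.+ + 2 ℤ.* + l ≡ + m ℤ.+ (+ 2 ℤ.* (k′ ℤ.* k′) ℤ.- k′) →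
             κ s k * q²^ l ≈ X t m * κ (ℤ.- s) k′
    κ-step s t k k′ l m x-exponent q-exponent = begin
      κ s k * q²^ l                               ≈⟨ X-* _ _ _ _ ⟩
      X (s ℤ.* k ℤ.+ 0ℤ) (expo k ℕ.+ 2 ℕ.* l)
        ≈⟨ X-cong (≡.trans (ℤₚ.+-identityʳ _) x-exponent) (ℤₚ.+-injective (≡.trans
             (cong₂ ℤ._+_ (expo-+ k) (ℤₚ.pos-* 2 l))
             (≡.trans q-exponent (cong (λ z → + m ℤ.+ z) (≡.sym (expo-+ k′)))))) ⟩
      X (t ℤ.+ ℤ.- s ℤ.* k′) (m ℕ.+ expo k′)      ≈⟨ X-* _ _ _ _ ⟨
      X t m * κ (ℤ.- s) k′                        ∎

    -- The shifted half of the Pascal rule is reindexed by k = 1 - k′, which splits off x^s q^(2n+1)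
    -- and inverts x.
    D-odd : ∀ {m} n s → m ≡ n ℕ.+ n → D (suc m) n s ≈ D m n s + X s (suc m) * D m n (ℤ.- s)
    D-odd {m} n s m≡2n = begin
      D (suc m) n s
        ≈⟨ S-pascal′ m (λ i → κ s (+ i ℤ.- + n)) ⟩
      D m n s + S m (λ i j → κ s (+ suc i ℤ.- + n) * q²^ j * B i j)
        ≈⟨ +-congˡ (S-cong m λ i j e → *-congʳ (step i j (≡.trans e m≡2n))) ⟩
      D m n s + S m (λ i j → X s (suc m) * κ (ℤ.- s) (+ j ℤ.- + n) * B i j)
        ≈⟨ +-congˡ (scale-flip m (X s (suc m)) (λ i → κ (ℤ.- s) (+ i ℤ.- + n))) ⟨
      D m n s + X s (suc m) * D m n (ℤ.- s) ∎
      where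
      x-exponent : ∀ s j n → s ℤ.* (1ℤ ℤ.+ (n ℤ.+ n ℤ.- j) ℤ.- n) ≡ s ℤ.+ ℤ.- s ℤ.* (j ℤ.- n)
      x-exponent = solve-∀
      q-exponent : ∀ j n → let k = 1ℤ ℤ.+ (n ℤ.+ n ℤ.- j) ℤ.- n in
        + 2 ℤ.* (k ℤ.* k) ℤ.- k ℤ.+ + 2 ℤ.* j
          ≡ (1ℤ ℤ.+ (n ℤ.+ n)) ℤ.+ (+ 2 ℤ.* ((j ℤ.- n) ℤ.* (j ℤ.- n)) ℤ.- (j ℤ.- n))
      q-exponent = solve-∀
      step : ∀ i j → i ℕ.+ j ≡ n ℕ.+ n → κ s (+ suc i ℤ.- + n) * q²^ j ≈ X s (suc m) * κ (ℤ.- s) (+ j ℤ.- + n)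
      step i j e rewrite m≡2n = κ-step s s (+ suc i ℤ.- + n) (+ j ℤ.- + n) j (suc (n ℕ.+ n))
        (≡.trans (cong (λ z → s ℤ.* (1ℤ ℤ.+ z ℤ.- + n)) i≡) (x-exponent s (+ j) (+ n)))
        (≡.trans (cong (λ z → let k = 1ℤ ℤ.+ z ℤ.- + n in + 2 ℤ.* (k ℤ.* k) ℤ.- k ℤ.+ + 2 ℤ.* + j) i≡)
                 (q-exponent (+ j) (+ n)))
        where
        i≡ : + i ≡ + n ℤ.+ + n ℤ.- + j
        i≡ = solve-summand e

    -- Raising `n` by one undoes the shift in one half of the Pascal rule. The other half is
    -- reindexed by k = -k′, which splits off q^(2n+2) without any power of x.
    D-even : ∀ {m} n s → m ≡ suc (n ℕ.+ n) → D (suc m) (suc n) s ≈ D m n s + X 0ℤ (suc m) * D m n (ℤ.- s)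
    D-even {m} n s m≡2n+1 = begin
      D (suc m) (suc n) s
        ≈⟨ S-pascal m (λ i → κ s (+ i ℤ.- + suc n)) ⟩
      S m (λ i j → κ s (+ suc i ℤ.- + suc n) * B i j) + S m (λ i j → κ s (+ i ℤ.- + suc n) * q²^ i * B i j)
        ≈⟨ +-cong (S-cong m λ i j _ → *-congʳ (reflexive (cong (κ s) (shift (+ i) (+ n)))))
                  (S-cong m λ i j e → *-congʳ (step i j (≡.trans e m≡2n+1))) ⟩
      D m n s + S m (λ i j → X 0ℤ (suc m) * κ (ℤ.- s) (+ j ℤ.- + n) * B i j)
        ≈⟨ +-congˡ (scale-flip m (X 0ℤ (suc m)) (λ i → κ (ℤ.- s) (+ i ℤ.- + n))) ⟨
      D m n s + X 0ℤ (suc m) * D m n (ℤ.- s) ∎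
      where
      shift : ∀ i n → 1ℤ ℤ.+ i ℤ.- (1ℤ ℤ.+ n) ≡ i ℤ.- n
      shift = solve-∀
      x-exponent : ∀ s i n → s ℤ.* (i ℤ.- (1ℤ ℤ.+ n)) ≡ 0ℤ ℤ.+ ℤ.- s ℤ.* (1ℤ ℤ.+ (n ℤ.+ n) ℤ.- i ℤ.- n)
      x-exponent = solve-∀
      q-exponent : ∀ i n → let k = i ℤ.- (1ℤ ℤ.+ n) ; k′ = 1ℤ ℤ.+ (n ℤ.+ n) ℤ.- i ℤ.- n in
        + 2 ℤ.* (k ℤ.* k) ℤ.- k ℤ.+ + 2 ℤ.* i ≡ (1ℤ ℤ.+ (1ℤ ℤ.+ (n ℤ.+ n))) ℤ.+ (+ 2 ℤ.* (k′ ℤ.* k′) ℤ.- k′)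
      q-exponent = solve-∀
      step : ∀ i j → i ℕ.+ j ≡ suc (n ℕ.+ n) → κ s (+ i ℤ.- + suc n) * q²^ i ≈ X 0ℤ (suc m) * κ (ℤ.- s) (+ j ℤ.- + n)
      step i j e rewrite m≡2n+1 = κ-step s 0ℤ (+ i ℤ.- + suc n) (+ j ℤ.- + n) i (suc (suc (n ℕ.+ n)))
        (≡.trans (x-exponent s (+ i) (+ n)) (cong (λ z → 0ℤ ℤ.+ ℤ.- s ℤ.* (z ℤ.- + n)) (≡.sym j≡)))
        (≡.trans (q-exponent (+ i) (+ n))
          (cong (λ z → let k′ = z ℤ.- + n in (1ℤ ℤ.+ (1ℤ ℤ.+ (+ n ℤ.+ + n))) ℤ.+ (+ 2 ℤ.* (k′ ℤ.* k′) ℤ.- k′)) (≡.sym j≡)))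
        where
        j≡ : + j ≡ 1ℤ ℤ.+ (+ n ℤ.+ + n) ℤ.- + i
        j≡ = solve-summand (≡.trans (ℕₚ.+-comm j i) e)

    C : ℕ → ℤ → Carrier
    C zero    s = 1#
    C (suc m) s = C m s + X (s ℤ.* parity (suc m)) (suc m) * C m (ℤ.- s)

    C-step : ∀ {m t s y y′} → s ℤ.* parity (suc m) ≡ t → C m s ≈ y → C m (ℤ.- s) ≈ y′ →
             C (suc m) s ≈ y + X t (suc m) * y′
    C-step a b b′ = +-cong b (*-cong (X-cong a ≡.refl) b′)

    -- `C` and `D` agree at 0 and obey the same recurrence. The induction alternates between the
    -- parities because the shift of `D` grows only on reaching an even index.
    C-even : ∀ n s → C (double n) s ≈ D (double n) n s
    C-odd  : ∀ n s → C (suc (double n)) s ≈ D (suc (double n)) n s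

    C-even zero s = sym (trans (*-cong (trans (X-cong (ℤₚ.*-zeroʳ s) ≡.refl) X-one)
        (trans (*-cong (trans (*-congʳ poch-zero) (*-identityˡ _)) ipoch-zero) (trans (*-identityʳ _) ipoch-zero)))
        (*-identityˡ _))
    C-even (suc n) s = trans
      (C-step (≡.trans (cong (s ℤ.*_) (parity-double (suc n))) (ℤₚ.*-zeroʳ s)) (C-odd n s) (C-odd n (ℤ.- s)))
      (sym (D-even n s (cong suc (double-+ n))))

    C-odd n s = trans
      (C-step (≡.trans (cong (λ z → s ℤ.* (1ℤ ℤ.- z)) (parity-double n)) (ℤₚ.*-identityʳ s)) (C-even n s) (C-even n (ℤ.- s)))
      (sym (D-odd n s (double-+ n)))

    -- The sum over j of the theorem, with the prefactor x^(-n) or x^(n+1) absorbed into the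
    -- exponent `ε m i`.
    E : ℕ → ℤ → Carrier
    E m s = S m (λ i j → X (s ℤ.* ε m i) i * B i j)

    H : ℕ → ℤ → Carrier
    H m s = X 0ℤ (triangle m) * ipoch m * E m s

    -- Each term is split by 1 = q^(2j) + (1 - q^(2j)). The first part is reflected into the same
    -- sum at 1/x; the second is absorbed and leaves the sum for `m`.
    E-step : ∀ m s → E (suc m) s ≈ X (s ℤ.* parity (suc m)) (suc m) * E (suc m) (ℤ.- s)
                                  + X (s ℤ.* parity (suc m)) 0 * d (suc m) * E m (ℤ.- s)
    E-step m s = begin
      S (suc m) (λ i j → X (s ℤ.* ε (suc m) i) i * B i j)
        ≈⟨ S-cong (suc m) term ⟩
      S (suc m) (λ i j → X a (suc m) * X (ℤ.- s ℤ.* ε (suc m) j) j * B i j + X (s ℤ.* ε (suc m) i) i * d (suc m) * B⁻ʳ i j)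
        ≈⟨ trans (S-+ (suc m) (λ i j → X a (suc m) * X (ℤ.- s ℤ.* ε (suc m) j) j * B i j)
                              (λ i j → X (s ℤ.* ε (suc m) i) i * d (suc m) * B⁻ʳ i j))
             (+-cong (sym (scale-flip (suc m) (X a (suc m)) (λ i → X (ℤ.- s ℤ.* ε (suc m) i) i)))
             (S-dropʳ m (λ i j → X (s ℤ.* ε (suc m) i) i * d (suc m)))) ⟩
      X a (suc m) * E (suc m) (ℤ.- s) + S m (λ i j → X (s ℤ.* ε (suc m) i) i * d (suc m) * B i j)
        ≈⟨ +-congˡ (trans (S-cong m term′) (sym (S-*ˡ m _ _))) ⟩
      X a (suc m) * E (suc m) (ℤ.- s) + X a 0 * d (suc m) * E m (ℤ.- s) ∎
      where
      a = s ℤ.* parity (suc m)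
      lemma : ∀ s p e → s ℤ.* (p ℤ.- e) ≡ s ℤ.* p ℤ.+ ℤ.- s ℤ.* e
      lemma = solve-∀

      term′ : ∀ i j → i ℕ.+ j ≡ m → X (s ℤ.* ε (suc m) i) i * d (suc m) * B i j
                                  ≈ X a 0 * d (suc m) * (X (ℤ.- s ℤ.* ε m i) i * B i j)
      term′ i j _ = trans
        (*-congʳ (*-congʳ (trans (X-cong (lemma s (parity (suc m)) (ε m i)) ≡.refl) (sym (X-* _ _ 0 i)))))
        (solve 4 (λ x y z w → x :* y :* z :* w := x :* z :* (y :* w)) refl _ _ _ _)

      move : ∀ i j → i ℕ.+ j ≡ suc m → X (s ℤ.* ε (suc m) i) i * q²^ j ≈ X a (suc m) * X (ℤ.- s ℤ.* ε (suc m) j) j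
      move i j e = trans (X-* _ _ _ _) (trans
        (X-cong (≡.trans (ℤₚ.+-identityʳ _) (≡.trans (cong (s ℤ.*_) (ε-reflect i j e)) (lemma s (parity (suc m)) (ε (suc m) j))))
                (≡.trans (cong (λ z → i ℕ.+ (j ℕ.+ z)) (ℕₚ.+-identityʳ j)) (≡.trans (≡.sym (ℕₚ.+-assoc i j j)) (cong (ℕ._+ j) e))))
        (sym (X-* _ _ _ _)))

      term : ∀ i j → i ℕ.+ j ≡ suc m → X (s ℤ.* ε (suc m) i) i * B i j
        ≈ X a (suc m) * X (ℤ.- s ℤ.* ε (suc m) j) j * B i j + X (s ℤ.* ε (suc m) i) i * d (suc m) * B⁻ʳ i j
      term i j e = begin
        x * B i j                                ≈⟨ *-congˡ (*-identityˡ _) ⟨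
        x * (1# * B i j)                         ≈⟨ *-congˡ (*-congʳ (d+q² j)) ⟨
        x * ((d j + q²^ j) * B i j)              ≈⟨ solve 4 (λ x y z w → x :* ((y :+ z) :* w) := x :* z :* w :+ x :* (y :* w)) refl _ _ _ _ ⟩
        x * q²^ j * B i j + x * (d j * B i j)    ≈⟨ +-cong (*-congʳ (move i j e)) (*-congˡ (trans (absorb i j) (*-congʳ (reflexive (cong d e))))) ⟩
        X a (suc m) * X (ℤ.- s ℤ.* ε (suc m) j) j * B i j + x * (d (suc m) * B⁻ʳ i j)
          ≈⟨ +-congˡ (*-assoc _ _ _) ⟨
        X a (suc m) * X (ℤ.- s ℤ.* ε (suc m) j) j * B i j + x * d (suc m) * B⁻ʳ i j ∎
        where x = X (s ℤ.* ε (suc m) i) i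

    -- In the second summand of `E-step`, `d (suc m)` cancels against `ipoch (suc m)`, and the step
    -- of `triangle` supplies the q^(m+1) that the first summand already carries.
    H-step : ∀ m s → H (suc m) s ≈ X (s ℤ.* parity (suc m)) (suc m) * (H (suc m) (ℤ.- s) + H m (ℤ.- s))
    H-step m s = begin
      T′ * I′ * E (suc m) s
        ≈⟨ *-congˡ (E-step m s) ⟩
      T′ * I′ * (x * E (suc m) (ℤ.- s) + y * d (suc m) * E m (ℤ.- s))
        ≈⟨ solve 7 (λ t i x e y d e′ → t :* i :* (x :* e :+ y :* d :* e′) := x :* (t :* i :* e) :+ y :* t :* (d :* i) :* e′) refl _ _ _ _ _ _ _ ⟩
      x * H (suc m) (ℤ.- s) + y * T′ * (d (suc m) * I′) * E m (ℤ.- s)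
        ≈⟨ +-congˡ (*-congʳ (*-cong split (ipoch-suc m))) ⟩
      x * H (suc m) (ℤ.- s) + x * T * ipoch m * E m (ℤ.- s)
        ≈⟨ solve 5 (λ x h t i e → x :* h :+ x :* t :* i :* e := x :* (h :+ t :* i :* e)) refl _ _ _ _ _ ⟩
      x * (H (suc m) (ℤ.- s) + H m (ℤ.- s)) ∎
      where
      x = X (s ℤ.* parity (suc m)) (suc m)
      y = X (s ℤ.* parity (suc m)) 0
      T = X 0ℤ (triangle m)
      T′ = X 0ℤ (triangle (suc m))
      I′ = ipoch (suc m)
      split : y * T′ ≈ x * T
      split = trans (X-* _ _ _ _) (sym (X-* _ _ _ _))

    H-zero : ∀ s → H 0 s ≈ 1#
    -- `E 0 s` and `D 0 0 s` are the same single term, and `C 0 s` is 1.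
    H-zero s = trans (*-cong (trans (*-cong X-one ipoch-zero) (*-identityˡ _)) (sym (C-even 0 s))) (*-identityˡ _)

    G : ℕ → ℕ → ℤ → Carrier
    G M       zero    s = 1#
    G zero    (suc m) s = 0#
    G (suc M) (suc m) s = G M (suc m) s + X (s ℤ.* parity (suc M)) (suc M) * G M m (ℤ.- s)

    -- G is defined by removing the first row; this is the recurrence for removing the first column.
    G-column : ∀ M m s → G (suc M) (suc m) s ≈ X (s ℤ.* parity (suc m)) (suc m) * (G M (suc m) (ℤ.- s) + G M m (ℤ.- s))
    G-column zero    zero    s = trans (+-identityˡ _) (*-congˡ (sym (+-identityˡ _)))
    G-column zero    (suc m) s = trans (+-identityˡ _) (trans (zeroʳ _) (sym (trans (*-congˡ (+-identityˡ _)) (zeroʳ _))))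
    G-column (suc M) zero    s = begin
      G (suc M) 1 s + X (s ℤ.* parity (2 ℕ.+ M)) (2 ℕ.+ M) * 1#
        ≈⟨ +-cong (G-column M 0 s) (*-congʳ (trans (X-cong (lemma s (parity M)) ≡.refl) (sym (X-* _ _ 1 (suc M))))) ⟩
      X (s ℤ.* 1ℤ) 1 * (G M 1 (ℤ.- s) + 1#) + X (s ℤ.* 1ℤ) 1 * X (ℤ.- s ℤ.* parity (suc M)) (suc M) * 1#
        ≈⟨ solve 4 (λ x g o z → x :* (g :+ o) :+ x :* z :* o := x :* ((g :+ z :* o) :+ o)) refl _ _ _ _ ⟩
      X (s ℤ.* 1ℤ) 1 * (G (suc M) 1 (ℤ.- s) + 1#) ∎
      where
      lemma : ∀ s p → s ℤ.* (1ℤ ℤ.- (1ℤ ℤ.- p)) ≡ s ℤ.* 1ℤ ℤ.+ ℤ.- s ℤ.* (1ℤ ℤ.- p)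
      lemma = solve-∀
    G-column (suc M) (suc m) s = begin
      G (suc M) (2 ℕ.+ m) s + X (s ℤ.* parity (2 ℕ.+ M)) (2 ℕ.+ M) * G (suc M) (suc m) (ℤ.- s)
        ≈⟨ +-cong (G-column M (suc m) s) (*-congˡ (G-column M m (ℤ.- s))) ⟩
      x * (g₂ + g₁) + X (s ℤ.* parity (2 ℕ.+ M)) (2 ℕ.+ M) * (X (ℤ.- s ℤ.* parity (suc m)) (suc m) * (h₁ + h₀))
        -- Taking off the first row and then the first column, or the column and then the row,
        -- removes the same hook.
        ≈⟨ +-congˡ (trans (sym (*-assoc _ _ _)) (*-congʳ swap)) ⟩
      x * (g₂ + g₁) + x * z * (h₁ + h₀)
        ≈⟨ solve 6 (λ x g₂ g₁ z h₁ h₀ → x :* (g₂ :+ g₁) :+ x :* z :* (h₁ :+ h₀) := x :* ((g₂ :+ z :* h₁) :+ (g₁ :+ z :* h₀))) refl _ _ _ _ _ _ ⟩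
      x * ((g₂ + z * h₁) + (g₁ + z * h₀))
        ≡⟨⟩
      x * (G (suc M) (2 ℕ.+ m) (ℤ.- s) + G (suc M) (suc m) (ℤ.- s)) ∎
      where
      x = X (s ℤ.* parity (2 ℕ.+ m)) (2 ℕ.+ m)
      z = X (ℤ.- s ℤ.* parity (suc M)) (suc M)
      g₂ = G M (2 ℕ.+ m) (ℤ.- s)
      g₁ = G M (suc m) (ℤ.- s)
      h₁ = G M (suc m) (ℤ.- ℤ.- s)
      h₀ = G M m (ℤ.- ℤ.- s)
      lemma : ∀ s p r → s ℤ.* (1ℤ ℤ.- (1ℤ ℤ.- p)) ℤ.+ ℤ.- s ℤ.* (1ℤ ℤ.- r)
                      ≡ s ℤ.* (1ℤ ℤ.- (1ℤ ℤ.- r)) ℤ.+ ℤ.- s ℤ.* (1ℤ ℤ.- p)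
      lemma = solve-∀
      swap : X (s ℤ.* parity (2 ℕ.+ M)) (2 ℕ.+ M) * X (ℤ.- s ℤ.* parity (suc m)) (suc m) ≈ x * z
      swap = trans (X-* _ _ _ _) (trans (X-cong (lemma s (parity M) (parity m))
        (cong suc (≡.trans (cong suc (ℕₚ.+-comm M (suc m))) (≡.sym (ℕₚ.+-suc (suc m) M))))) (sym (X-* _ _ _ _)))

-- The two terms of the right-hand side

poch2-constant : ∀ m → poch2 m 0 L.≈ lone
poch2-constant zero    = L.refl
poch2-constant (suc m) = L.trans
  (*ₛ-coeff (poch2 m) (sone +ₛ (-ₛ mono 0ℤ (+ (2 ℕ.* suc m)))) 0)
  (L.trans (L.*-congʳ (poch2-constant m)) (L.*-identityˡ lone))

X : ℤ → ℕ → Series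
X a n = mono a (+ n)

X-one : X 0ℤ 0 Q.≈ sone
X-one = Q.coeffwise λ where
  zero    → L.refl
  (suc N) → L.refl

open ClosedForms Q.series-commutativeRing X mono-* X-one poch2 (inv ∘ poch2) Q.refl (λ _ → Q.refl)
  (λ m → inv-inverseʳ (poch2 m) (poch2-constant m))

qbin2-B : ∀ i j → qbin2 (i ℕ.+ j) i Q.≈ B i j
qbin2-B i j rewrite Equivalence.to T-≡ (ℕₚ.≤⇒≤ᵇ (ℕₚ.m≤m+n i j)) | ℕₚ.m+n∸m≡n i j = Q.refl

Σₛ-antidiagonal : ∀ m (F : ℕ → Series) → Σₛ (suc m) F Q.≈ Q.S m (λ i j → F i)
Σₛ-antidiagonal zero    F = Q.+-identityˡ (F 0)
Σₛ-antidiagonal (suc m) F = Q.trans (Q.+-congʳ {x = F (suc m)} (Σₛ-antidiagonal m F)) (Q.sym (Q.S-last m (λ i j → F i)))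

Σₛ-qbin2 : ∀ m (F : ℕ → Series) → Σₛ (suc m) (λ i → F i *ₛ qbin2 m i) Q.≈ Q.S m (λ i j → F i *ₛ B i j)
Σₛ-qbin2 m F = Q.trans (Σₛ-antidiagonal m (λ i → F i *ₛ qbin2 m i))
  (Q.S-cong m λ { i j ≡.refl → Q.*-congˡ {F i} (qbin2-B i j) })

kmono-κ : ∀ k → kmono k Q.≈ κ 1ℤ k
kmono-κ k = Q.reflexive (cong₂ mono (≡.sym (ℤₚ.*-identityˡ k)) (≡.sym (expo-+ k)))

double-* : ∀ n → double n ≡ 2 ℕ.* n
double-* n = ≡.trans (double-+ n) (cong (n ℕ.+_) (≡.sym (ℕₚ.+-identityʳ n)))

-- Distributing x^a over the sum turns the exponent `f i` into `ε m i`; one argument thus serves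
-- both terms of the theorem.
H-factor : ∀ m a t (f : ℕ → ℤ) → t ≡ triangle m → (∀ i → ε m i ≡ a ℤ.+ f i) →
  ((X a t *ₛ inv (poch2 m)) *ₛ Q.S m (λ i j → X (f i) i *ₛ B i j)) Q.≈ H m 1ℤ
H-factor m a t f ≡.refl h = begin
  (X a t * I) * Q.S m (λ i j → X (f i) i * B i j)
    ≈⟨ *-congʳ (*-congʳ (trans (X-cong (≡.sym (ℤₚ.+-identityʳ a)) ≡.refl) (sym (mono-* a 0ℤ 0 t)))) ⟩
  ((X a 0 * X 0ℤ t) * I) * Q.S m (λ i j → X (f i) i * B i j)
    ≈⟨ solve 4 (λ x y z w → ((x :* y) :* z) :* w := (y :* z) :* (x :* w)) refl (X a 0) (X 0ℤ t) I _ ⟩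
  (X 0ℤ t * I) * (X a 0 * Q.S m (λ i j → X (f i) i * B i j))
    ≈⟨ *-congˡ {X 0ℤ t * I} (trans (Q.S-*ˡ m (X a 0) (λ i j → X (f i) i * B i j)) (Q.S-cong m λ i j _ →
         trans (sym (*-assoc (X a 0) (X (f i) i) (B i j)))
         (*-congʳ {B i j} (trans (mono-* a (f i) 0 i) (X-cong (≡.trans (≡.sym (h i)) (≡.sym (ℤₚ.*-identityˡ _))) ≡.refl))))) ⟩
  H m 1ℤ ∎
  where
  open CommutativeRing Q.series-commutativeRing using (_*_; *-congʳ; *-congˡ; *-assoc; trans; sym; refl; setoid; commutativeSemiring)
  open SetoidReasoning setoid
  open import Algebra.Solver.Ring.NaturalCoefficients.Default commutativeSemiring
    using (solve; _:*_; _:=_)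
  I = inv (poch2 m)

ε-even : ∀ n i → ε (double n) i ≡ ℤ.- (+ n) ℤ.+ + i
ε-odd  : ∀ n i → ε (suc (double n)) i ≡ + suc n ℤ.+ ℤ.- (+ i)
ε-even zero    i = ≡.refl
ε-even (suc n) i = ≡.trans (cong₂ ℤ._-_ (parity-double (suc n)) (ε-odd n i)) (lemma (+ n) (+ i))
  where
  lemma : ∀ n i → 0ℤ ℤ.- (1ℤ ℤ.+ n ℤ.+ ℤ.- i) ≡ ℤ.- (1ℤ ℤ.+ n) ℤ.+ i
  lemma = solve-∀
ε-odd n i = ≡.trans (cong₂ (λ p e → 1ℤ ℤ.- p ℤ.- e) (parity-double n) (ε-even n i)) (lemma (+ n) (+ i))
  where
  lemma : ∀ n i → 1ℤ ℤ.- 0ℤ ℤ.- (ℤ.- n ℤ.+ i) ≡ 1ℤ ℤ.+ n ℤ.+ ℤ.- i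
  lemma = solve-∀

-- The exponents n(2n+1) and (n+1)(2n+1) of the theorem are the triangular numbers of index 2n and
-- 2n+1.
triangle-even : ∀ n → triangle (double n) ≡ n ℕ.* (double n ℕ.+ 1)
triangle-odd  : ∀ n → triangle (suc (double n)) ≡ suc n ℕ.* (double n ℕ.+ 1)
triangle-even zero    = ≡.refl
triangle-even (suc n) rewrite triangle-odd n | double-+ n = lemma n
  where
  lemma : ∀ n → suc (suc (n ℕ.+ n)) ℕ.+ suc n ℕ.* (n ℕ.+ n ℕ.+ 1) ≡ suc n ℕ.* (suc (suc (n ℕ.+ n)) ℕ.+ 1)
  lemma = ℕ-RingSolver.solve-∀
triangle-odd n = ≡.trans (cong (suc (double n) ℕ.+_) (triangle-even n))
  (cong (ℕ._+ n ℕ.* (double n ℕ.+ 1)) (ℕₚ.+-comm 1 (double n)))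

Σₛ-D : ∀ m n → Σₛ (suc m) (λ k → kmono (+ k ℤ.- + n) *ₛ qbin2 m k) Q.≈ D m n 1ℤ
Σₛ-D m n = Q.trans (Σₛ-qbin2 m (λ k → kmono (+ k ℤ.- + n)))
  (Q.S-cong m λ i j _ → Q.*-congʳ {B i j} (kmono-κ (+ i ℤ.- + n)))

term₁-closed : ∀ n → term₁ n Q.≈ (H (double n) 1ℤ *ₛ C (double n) 1ℤ)
term₁-closed n rewrite ≡.sym (double-* n) = Q.*-cong
  (Q.trans (Q.*-congˡ {X (ℤ.- (+ n)) (n ℕ.* (double n ℕ.+ 1)) *ₛ inv (poch2 (double n))} (Σₛ-qbin2 (double n) (λ j → mono (+ j) (+ j))))
    (H-factor (double n) (ℤ.- (+ n)) _ (λ i → + i) (≡.sym (triangle-even n)) (ε-even n)))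
  (Q.trans (Σₛ-D (double n) n) (Q.sym (C-even n 1ℤ)))

term₂-closed : ∀ n → term₂ n Q.≈ (H (suc (double n)) 1ℤ *ₛ C (suc (double n)) 1ℤ)
term₂-closed n rewrite ≡.sym (double-* n) | ℕₚ.+-comm (double n) 1 = Q.*-cong
  (Q.trans (Q.*-congˡ {X (+ suc n) (suc n ℕ.* suc (double n)) *ₛ inv (poch2 (suc (double n)))} (Σₛ-qbin2 (suc (double n)) (λ j → mono (ℤ.- (+ j)) (+ j))))
    (H-factor (suc (double n)) (+ suc n) _ (λ i → ℤ.- (+ i))
      (≡.sym (≡.trans (triangle-odd n) (cong (suc n ℕ.*_) (ℕₚ.+-comm (double n) 1)))) (ε-odd n)))
  (Q.trans (Σₛ-D (suc (double n)) n) (Q.sym (C-odd n 1ℤ)))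

-- Comparison of series up to a given degree

_≈[_]_ : Series → ℕ → Series → Set
f ≈[ M ] g = ∀ N → N ℕ.≤ M → f N L.≈ g N

*ₛ-truncated : ∀ {f f′ M} g → f ≈[ M ] f′ → (f *ₛ g) ≈[ M ] (f′ *ₛ g)
*ₛ-truncated {f} {f′} g h N N≤M = L.trans (*ₛ-coeff f g N) (L.trans
  (L.S-cong N λ i j e → L.*-congʳ (h i (ℕₚ.≤-trans (ℕₚ.m+n≤o⇒m≤o i (ℕₚ.≤-reflexive e)) N≤M)))
  (L.sym (*ₛ-coeff f′ g N)))

X-*-constant : ∀ a n f → (X a (suc n) *ₛ f) 0 L.≈ lzero
X-*-constant a n f = *ₛ-coeff (X a (suc n)) f 0

-- The monomial has positive degree, so the coefficient of degree `suc N` of the product involves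
-- the other factor only up to degree `N`.
X-*-truncated : ∀ {f g M} a n → f ≈[ M ] g → (X a (suc n) *ₛ f) ≈[ suc M ] (X a (suc n) *ₛ g)
X-*-truncated {f} {g} a n h zero    _         = L.trans (X-*-constant a n f) (L.sym (X-*-constant a n g))
X-*-truncated {f} {g} a n h (suc N) (s≤s N≤M) = L.trans (*ₛ-coeff (X a (suc n)) f (suc N)) (L.trans
  (L.S-cong N λ i j e → L.*-congˡ {X a (suc n) (suc i)} (h j (ℕₚ.≤-trans (ℕₚ.m+n≤o⇒n≤o i (ℕₚ.≤-reflexive e)) N≤M)))
  (L.sym (*ₛ-coeff (X a (suc n)) g (suc N))))

-- Both sides satisfy the first-column recurrence, which raises the degree by at least one.
H-truncated : ∀ M m s → H m s ≈[ M ] G M m s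
H-truncated M       zero    s N _     = H-zero s Q.at N
H-truncated zero    (suc m) s .0 z≤n  = L.trans (H-step m s Q.at 0)
  (X-*-constant (s ℤ.* parity (suc m)) m (H (suc m) (ℤ.- s) +ₛ H m (ℤ.- s)))
H-truncated (suc M) (suc m) s N N≤1+M = L.trans (H-step m s Q.at N) (L.trans
  (X-*-truncated (s ℤ.* parity (suc m)) m
    (λ N N≤M → L.+-cong (H-truncated M (suc m) (ℤ.- s) N N≤M) (H-truncated M m (ℤ.- s) N N≤M)) N N≤1+M)
  (L.sym (G-column M m s Q.at N)))

Σₛ-double : ∀ K N (F F₁ F₂ : ℕ → Series) → (∀ n → F₁ n N L.≈ F (double n) N) →
  (∀ n → F₂ n N L.≈ F (suc (double n)) N) → Σₛ K (λ n → F₁ n +ₛ F₂ n) N L.≈ Σₛ (double K) F N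
Σₛ-double zero    N F F₁ F₂ h₁ h₂ = L.refl
Σₛ-double (suc K) N F F₁ F₂ h₁ h₂ = L.trans
  (L.+-cong (Σₛ-double K N F F₁ F₂ h₁ h₂) (L.+-cong (h₁ K) (h₂ K)))
  (L.sym (L.+-assoc (Σₛ (double K) F N) (F (double K) N) (F (suc (double K)) N)))

-- The summands n ≤ N cover the indices m = 2n and m = 2n+1 below 2N+2, and in degree `N` each `H m`
-- may be replaced by `G N m`.
RHS-truncated : ∀ N → RHS N L.≈ Σₛ (double (suc N)) (λ m → C m 1ℤ *ₛ G N m 1ℤ) N
RHS-truncated N = Σₛ-double (suc N) N (λ m → C m 1ℤ *ₛ G N m 1ℤ) term₁ term₂
  (λ n → L.trans (term₁-closed n Q.at N) (approx (double n)))
  (λ n → L.trans (term₂-closed n Q.at N) (approx (suc (double n))))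
  where
  approx : ∀ m → (H m 1ℤ *ₛ C m 1ℤ) N L.≈ (C m 1ℤ *ₛ G N m 1ℤ) N
  approx m = L.trans (*ₛ-truncated (C m 1ℤ) (H-truncated N m 1ℤ) N ℕₚ.≤-refl)
    (Q.*-comm (G N m 1ℤ) (C m 1ℤ) Q.at N)

-- Enumeration of pairs of partitions

gf : ∀ {A : Set} → (A → ℤ) → (A → ℕ) → List A → Series
gf w z []       = szero
gf w z (a ∷ as) = X (w a) (z a) +ₛ gf w z as

gf-++ : ∀ {A : Set} (w : A → ℤ) z as bs → gf w z (as ++ bs) Q.≈ (gf w z as +ₛ gf w z bs)
gf-++ w z []       bs = Q.sym (Q.+-identityˡ _)
gf-++ w z (a ∷ as) bs = Q.trans (Q.+-congˡ {X (w a) (z a)} (gf-++ w z as bs))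
  (Q.sym (Q.+-assoc (X (w a) (z a)) (gf w z as) (gf w z bs)))

gf-map : ∀ {A B : Set} (f : A → B) {w z w′ z′} c n →
  (∀ a → w′ (f a) ≡ c ℤ.+ w a) → (∀ a → z′ (f a) ≡ n ℕ.+ z a) →
  ∀ as → gf w′ z′ (map f as) Q.≈ (X c n *ₛ gf w z as)
gf-map f {w} {z} c n hw hz []       = Q.sym (Q.zeroʳ (X c n))
gf-map f {w} {z} c n hw hz (a ∷ as) = Q.trans
  (Q.+-cong (Q.trans (Q.reflexive (cong₂ X (hw a) (hz a))) (Q.sym (mono-* c (w a) n (z a))))
            (gf-map f c n hw hz as))
  (Q.sym (Q.distribˡ (X c n) (X (w a) (z a)) (gf w z as)))

gf-product : ∀ {A B : Set} (w : A → ℤ) z (w′ : B → ℤ) z′ as bs →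
  gf (λ (a , b) → w a ℤ.+ w′ b) (λ (a , b) → z a ℕ.+ z′ b) (cartesianProduct as bs) Q.≈ (gf w z as *ₛ gf w′ z′ bs)
gf-product w z w′ z′ []       bs = Q.sym (Q.zeroˡ (gf w′ z′ bs))
gf-product w z w′ z′ (a ∷ as) bs = Q.trans (gf-++ _ _ (map (a ,_) bs) (cartesianProduct as bs)) (Q.trans
  (Q.+-cong (gf-map (a ,_) (w a) (z a) (λ _ → ≡.refl) (λ _ → ≡.refl) bs) (gf-product w z w′ z′ as bs))
  (Q.sym (Q.distribʳ (gf w′ z′ bs) (X (w a) (z a)) (gf w z as))))

-- The test function is the indicator of `w`, so equality under all pairings implies equality of
-- coefficients.
coeffX-pair : ∀ p w → coeffX p w ≡ ⟨ p , (λ e → coeffX ((e , 1ℤ) ∷ []) w) ⟩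
coeffX-pair []            w = ≡.refl
coeffX-pair ((e , c) ∷ p) w with e ℤ.≟ w
... | yes _ = cong₂ ℤ._+_ (≡.sym (ℤₚ.*-identityʳ c)) (coeffX-pair p w)
... | no  _ = cong₂ ℤ._+_ (≡.sym (ℤₚ.*-zeroʳ c)) (coeffX-pair p w)

coeffX-++ : ∀ p r w → coeffX (p ++ r) w ≡ coeffX p w ℤ.+ coeffX r w
coeffX-++ p r w = ≡.trans (coeffX-pair (p ++ r) w)
  (≡.trans (pair-++ p r _) (≡.sym (cong₂ ℤ._+_ (coeffX-pair p w) (coeffX-pair r w))))

coeffX-cong : ∀ {p r} → p L.≈ r → ∀ w → coeffX p w ≡ coeffX r w
coeffX-cong {p} {r} h w = ≡.trans (coeffX-pair p w) (≡.trans (h on _) (≡.sym (coeffX-pair r w)))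

module _ {A : Set} (w : A → ℤ) (z : A → ℕ) (N : ℕ) (v : ℤ) where
  HasWeight : A → Set
  HasWeight a = (z a ≡ N) × (w a ≡ v)

  hasWeight? : Decidable HasWeight
  hasWeight? a = (z a ℕ.≟ N) ×-dec (w a ℤ.≟ v)

  private
    accept : ∀ {a} → z a ≡ N → w a ≡ v → coeffX (X (w a) (z a) N) v ≡ 1ℤ
    accept {a} zN wv with + N ℤ.≟ + z a
    ... | no ¬e = contradiction (cong +_ (≡.sym zN)) ¬e
    ... | yes _ with w a ℤ.≟ v
    ...   | yes _ = ≡.refl
    ...   | no ¬e = contradiction wv ¬e

    reject : ∀ {a} → ¬ HasWeight a → coeffX (X (w a) (z a) N) v ≡ 0ℤ
    reject {a} ¬h with + N ℤ.≟ + z a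
    ... | no _  = ≡.refl
    ... | yes e with w a ℤ.≟ v
    ...   | yes wv = contradiction (≡.sym (ℤₚ.+-injective e) , wv) ¬h
    ...   | no _   = ≡.refl

  coeffX-gf : ∀ as → coeffX (gf w z as N) v ≡ + length (filter hasWeight? as)
  coeffX-gf []       = ≡.refl
  coeffX-gf (a ∷ as) = ≡.trans (coeffX-++ (X (w a) (z a) N) (gf w z as N) v)
    (≡.trans (cong (λ y → coeffX (X (w a) (z a) N) v ℤ.+ y) (coeffX-gf as)) head)
    where
    head : coeffX (X (w a) (z a) N) v ℤ.+ + length (filter hasWeight? as) ≡ + length (filter hasWeight? (a ∷ as))
    head with hasWeight? a
    ... | yes (zN , wv) = ≡.trans (cong (ℤ._+ _) (accept zN wv)) (cong (+_ ∘ length) (≡.sym (Listₚ.filter-accept hasWeight? (zN , wv))))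
    ... | no  ¬h        = ≡.trans (cong (ℤ._+ _) (reject ¬h)) (≡.trans (ℤₚ.+-identityˡ _) (cong (+_ ∘ length) (≡.sym (Listₚ.filter-reject hasWeight? ¬h))))

-- Row weights in terms of parity

rowsWt : ℤ → List ℕ → ℤ
rowsWt s []       = 0ℤ
rowsWt s (l ∷ ls) = s ℤ.* parity l ℤ.+ rowsWt (ℤ.- s) ls

sgn-+ : ∀ m n → sgn (m ℕ.+ n) ≡ sgn m ℤ.* sgn n
sgn-+ zero    n = ≡.sym (ℤₚ.*-identityˡ (sgn n))
sgn-+ (suc m) n = ≡.trans (cong ℤ.-_ (sgn-+ m n)) (ℤₚ.neg-distribˡ-* (sgn m) (sgn n))

-- Residues alternate along a row, so nodes cancel in pairs; a row of odd length keeps the sign of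
-- its first node.
rowWeight-parity : ∀ i l → rowWeight i l ≡ sgn (suc i) ℤ.* parity l
rowWeight-parity i zero    = ≡.sym (ℤₚ.*-zeroʳ (sgn (suc i)))
rowWeight-parity i (suc l) = begin
  rowWeight i l ℤ.+ ℤ.- sgn (l ℕ.+ i)
    ≡⟨ cong₂ (λ y z → y ℤ.+ ℤ.- z) (rowWeight-parity i l) (sgn-+ l i) ⟩
  ℤ.- sgn i ℤ.* parity l ℤ.+ ℤ.- (sgn l ℤ.* sgn i)
    ≡⟨ lemma (sgn i) (parity l) (sgn l) ⟩
  ℤ.- sgn i ℤ.* (parity l ℤ.+ parity l ℤ.+ sgn l ℤ.- parity l)
    ≡⟨ cong (λ y → ℤ.- sgn i ℤ.* (y ℤ.- parity l)) (parity-sgn l) ⟩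
  ℤ.- sgn i ℤ.* (1ℤ ℤ.- parity l) ∎
  where
  open ≡.≡-Reasoning
  lemma : ∀ s p t → ℤ.- s ℤ.* p ℤ.+ ℤ.- (t ℤ.* s) ≡ ℤ.- s ℤ.* (p ℤ.+ p ℤ.+ t ℤ.- p)
  lemma = solve-∀

rowsWeight-rowsWt : ∀ i ls → rowsWeight i ls ≡ rowsWt (sgn (suc i)) ls
rowsWeight-rowsWt i []       = ≡.refl
rowsWeight-rowsWt i (l ∷ ls) = cong₂ ℤ._+_ (rowWeight-parity i l) (rowsWeight-rowsWt (suc i) ls)

-- Lists of strict partitions, built by the recursions of `C` and `G`

bounded : ℕ → List (List ℕ)
bounded zero    = [] ∷ []
bounded (suc m) = bounded m ++ map (suc m ∷_) (bounded m)

boundedOfLength : ℕ → ℕ → List (List ℕ)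
boundedOfLength M       zero    = [] ∷ []
boundedOfLength zero    (suc m) = []
boundedOfLength (suc M) (suc m) = boundedOfLength M (suc m) ++ map (suc M ∷_) (boundedOfLength M m)

gf-empty : ∀ s → gf (rowsWt s) sum ([] ∷ []) Q.≈ sone
gf-empty s = Q.trans (Q.+-identityʳ (X 0ℤ 0)) X-one

gf-bounded : ∀ m s → gf (rowsWt s) sum (bounded m) Q.≈ C m s
gf-bounded zero    s = gf-empty s
gf-bounded (suc m) s = Q.trans (gf-++ _ _ (bounded m) _) (Q.+-cong (gf-bounded m s) (Q.trans
  (gf-map (suc m ∷_) (s ℤ.* parity (suc m)) (suc m) (λ _ → ≡.refl) (λ _ → ≡.refl) (bounded m))
  (Q.*-congˡ {X (s ℤ.* parity (suc m)) (suc m)} (gf-bounded m (ℤ.- s)))))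

gf-boundedOfLength : ∀ M m s → gf (rowsWt s) sum (boundedOfLength M m) Q.≈ G M m s
gf-boundedOfLength M       zero    s = gf-empty s
gf-boundedOfLength zero    (suc m) s = Q.refl
gf-boundedOfLength (suc M) (suc m) s = Q.trans (gf-++ _ _ (boundedOfLength M (suc m)) _)
  (Q.+-cong (gf-boundedOfLength M (suc m) s) (Q.trans
    (gf-map (suc M ∷_) (s ℤ.* parity (suc M)) (suc M) (λ _ → ≡.refl) (λ _ → ≡.refl) (boundedOfLength M m))
    (Q.*-congˡ {X (s ℤ.* parity (suc M)) (suc M)} (gf-boundedOfLength M m (ℤ.- s)))))

-- The grouping is by the number of parts of the second component, which also bounds the parts of
-- the first. Bounding the parts of the second by `N` keeps the list finite and loses nothing at
-- total size `N`.
pairs : ℕ → ℕ → List (List ℕ × List ℕ)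
pairs N zero    = []
pairs N (suc K) = pairs N K ++ cartesianProduct (bounded K) (boundedOfLength N K)

weight : List ℕ × List ℕ → ℤ
weight (a , b) = rowsWt 1ℤ a ℤ.+ rowsWt 1ℤ b

total-size : List ℕ × List ℕ → ℕ
total-size (a , b) = sum a ℕ.+ sum b

gf-pairs : ∀ N K → gf weight total-size (pairs N K) Q.≈ Σₛ K (λ m → C m 1ℤ *ₛ G N m 1ℤ)
gf-pairs N zero    = Q.refl
gf-pairs N (suc K) = Q.trans (gf-++ _ _ (pairs N K) _) (Q.+-cong (gf-pairs N K)
  (Q.trans (gf-product (rowsWt 1ℤ) sum (rowsWt 1ℤ) sum (bounded K) (boundedOfLength N K))
           (Q.*-cong (gf-bounded K 1ℤ) (gf-boundedOfLength N K 1ℤ))))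

-- Prepending suc m to a decreasing list encodes the bound m on its largest part.
Bounded : ℕ → List ℕ → Set
Bounded m ls = Linked _>_ (suc m ∷ ls) × All (0 <_) ls

weaken : ∀ {m ls} → Bounded m ls → Bounded (suc m) ls
weaken ([-]   , p) = [-] , p
weaken (h ∷ l , p) = ℕₚ.m<n⇒m<1+n h ∷ l , p

extend : ∀ {m ls} → Bounded m ls → Bounded (suc m) (suc m ∷ ls)
extend (l , p) = ℕₚ.n<1+n _ ∷ l , s≤s z≤n ∷ p

bounded-sound : ∀ m {ls} → ls ∈ bounded m → Bounded m ls
bounded-sound zero    (here ≡.refl) = [-] , []
bounded-sound (suc m) x with ∈-++⁻ (bounded m) x
... | inj₁ y = weaken (bounded-sound m y)
... | inj₂ y with r , z , ≡.refl ← ∈-map⁻ (suc m ∷_) y = extend (bounded-sound m z)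

boundedOfLength-sound : ∀ M m {ls} → ls ∈ boundedOfLength M m → Bounded M ls × length ls ≡ m
boundedOfLength-sound M       zero    (here ≡.refl) = ([-] , []) , ≡.refl
boundedOfLength-sound (suc M) (suc m) x with ∈-++⁻ (boundedOfLength M (suc m)) x
... | inj₁ y with b , e ← boundedOfLength-sound M (suc m) y = weaken b , e
... | inj₂ y with r , z , ≡.refl ← ∈-map⁻ (suc M ∷_) y with b , e ← boundedOfLength-sound M m z = extend b , cong suc e

bounded-complete : ∀ m {ls} → Bounded m ls → ls ∈ bounded m
bounded-complete zero    {[]}     _ = here ≡.refl
-- A part below 1 is 0, against positivity.
bounded-complete zero    {_ ∷ _}  (s≤s z≤n ∷ _ , () ∷ _)
bounded-complete (suc m) {[]}     _ = ∈-++⁺ˡ (bounded-complete m ([-] , []))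
bounded-complete (suc m) {l ∷ ls} (s≤s h ∷ d , p ∷ ps) with l ℕ.≟ suc m
... | yes ≡.refl = ∈-++⁺ʳ (bounded m) (∈-map⁺ (suc m ∷_) (bounded-complete m (d , ps)))
... | no  l≢     = ∈-++⁺ˡ (bounded-complete m (ℕₚ.≤∧≢⇒< h l≢ ∷ d , p ∷ ps))

boundedOfLength-complete : ∀ M {ls} → Bounded M ls → ls ∈ boundedOfLength M (length ls)
boundedOfLength-complete M       {[]}     _ = here ≡.refl
boundedOfLength-complete zero    {_ ∷ _}  (s≤s z≤n ∷ _ , () ∷ _)
boundedOfLength-complete (suc M) {l ∷ ls} (s≤s h ∷ d , p ∷ ps) with l ℕ.≟ suc M
... | yes ≡.refl = ∈-++⁺ʳ (boundedOfLength M (suc (length ls))) (∈-map⁺ (suc M ∷_) (boundedOfLength-complete M (d , ps)))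
... | no  l≢     = ∈-++⁺ˡ (boundedOfLength-complete M (ℕₚ.≤∧≢⇒< h l≢ ∷ d , p ∷ ps))

-- Makes the two halves of each enumeration disjoint: only the second has lists beginning with the
-- maximal part.
not-bounded : ∀ {m ls} → ¬ Bounded m (suc m ∷ ls)
not-bounded (h ∷ _ , _) = ℕₚ.<-irrefl ≡.refl h

bounded-unique : ∀ m → Unique (bounded m)
bounded-unique zero    = [] ∷ []
bounded-unique (suc m) = Unique.++⁺ (bounded-unique m) (Unique.map⁺ Listₚ.∷-injectiveʳ (bounded-unique m)) disjoint
  where
  disjoint : Disjoint (bounded m) (map (suc m ∷_) (bounded m))
  disjoint (x , y) with r , _ , ≡.refl ← ∈-map⁻ (suc m ∷_) y = not-bounded (bounded-sound m x)

boundedOfLength-unique : ∀ M m → Unique (boundedOfLength M m)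
boundedOfLength-unique M       zero    = [] ∷ []
boundedOfLength-unique zero    (suc m) = []
boundedOfLength-unique (suc M) (suc m) = Unique.++⁺ (boundedOfLength-unique M (suc m))
  (Unique.map⁺ Listₚ.∷-injectiveʳ (boundedOfLength-unique M m)) disjoint
  where
  disjoint : Disjoint (boundedOfLength M (suc m)) (map (suc M ∷_) (boundedOfLength M m))
  disjoint (x , y) with r , _ , ≡.refl ← ∈-map⁻ (suc M ∷_) y = not-bounded (proj₁ (boundedOfLength-sound M (suc m) x))

pairs-sound : ∀ N K {a b} → (a , b) ∈ pairs N K → Bounded (length b) a × Bounded N b × length b < K
pairs-sound N (suc K) x with ∈-++⁻ (pairs N K) x
... | inj₁ y with p , q , r ← pairs-sound N K y = p , q , ℕₚ.m<n⇒m<1+n r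
... | inj₂ y with u , v ← ∈-cartesianProduct⁻ (bounded K) (boundedOfLength N K) y
             with q , ≡.refl ← boundedOfLength-sound N K v = bounded-sound K u , q , ℕₚ.n<1+n K

pairs-complete : ∀ N K {a b} → Bounded (length b) a → Bounded N b → length b < K → (a , b) ∈ pairs N K
pairs-complete N (suc K) {b = b} p q (s≤s r) with length b ℕ.≟ K
... | yes ≡.refl = ∈-++⁺ʳ (pairs N K) (∈-cartesianProduct⁺ (bounded-complete K p) (boundedOfLength-complete N q))
... | no  ≢K     = ∈-++⁺ˡ (pairs-complete N K p q (ℕₚ.≤∧≢⇒< r ≢K))

pairs-unique : ∀ N K → Unique (pairs N K)
pairs-unique N zero    = []
pairs-unique N (suc K) = Unique.++⁺ (pairs-unique N K)
  (Unique.cartesianProduct⁺ (bounded-unique K) (boundedOfLength-unique N K)) disjoint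
  where
  disjoint : Disjoint (pairs N K) (cartesianProduct (bounded K) (boundedOfLength N K))
  -- The second component has length `K` on one side and length below `K` on the other.
  disjoint (x , y) = ℕₚ.<-irrefl
    (proj₂ (boundedOfLength-sound N K (proj₂ (∈-cartesianProduct⁻ (bounded K) (boundedOfLength N K) y))))
    (proj₂ (proj₂ (pairs-sound N K x)))

-- From duplicate-free lists to bijections

lookup-injective : ∀ {A : Set} {as : List A} → Unique as → ∀ i j → lookup as i ≡ lookup as j → i ≡ j
lookup-injective (_ ∷ _)  zero    zero    _ = ≡.refl
lookup-injective (a ∷ _)  zero    (suc j) e = contradiction e (All.lookup a (∈-lookup j))
lookup-injective (a ∷ _)  (suc i) zero    e = contradiction (≡.sym e) (All.lookup a (∈-lookup i))
lookup-injective (_ ∷ as) (suc i) (suc j) e = cong suc (lookup-injective as i j e)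

-- `P` is matched with positions in the list through `f`; injectivity of `f` gives one inverse law
-- and absence of duplicates the other.
enumerate : ∀ {P A : Set} (f : P → A) (as : List A) → Unique as → (∀ {p q} → f p ≡ f q → p ≡ q) →
  (∀ p → f p ∈ as) → (∀ {a} → a ∈ as → ∃ λ p → f p ≡ a) → P ↔ Fin (length as)
enumerate f as unique f-injective mem preimage = mk↔ₛ′
  (λ p → index (mem p))
  (λ i → proj₁ (preimage (∈-lookup i)))
  (λ i → lookup-injective unique _ i
    (≡.trans (≡.sym (lookup-index (mem _))) (proj₂ (preimage (∈-lookup i)))))
  (λ p → f-injective (≡.trans (proj₂ (preimage (∈-lookup (index (mem p))))) (≡.sym (lookup-index (mem p)))))

underlying : ∀ {n w} → Λ22ω n w → List ℕ × List ℕ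
underlying (p , _) = parts (π₁ p) , parts (π₂ p)

-- The proofs of strictness and positivity are unique, because those of `_<_` on natural numbers
-- are.
mkDP-cong : ∀ {π ρ} → parts π ≡ parts ρ → π ≡ ρ
mkDP-cong {mkDP ls s p} {mkDP .ls t r} ≡.refl =
  cong₂ (mkDP ls) (Linked.irrelevant ℕₚ.<-irrelevant s t) (All.irrelevant ℕₚ.<-irrelevant p r)

underlying-injective : ∀ {n w} {p r : Λ22ω n w} → underlying p ≡ underlying r → p ≡ r
underlying-injective {p = mkΛ a b t c , e} {mkΛ a′ b′ t′ c′ , e′} h
  with ≡.refl ← mkDP-cong {a} {a′} (cong proj₁ h) | ≡.refl ← mkDP-cong {b} {b′} (cong proj₂ h)
  with ≡.refl ← ℕₚ.≡-irrelevant t t′ | ≡.refl ← ℕₚ.≤-irrelevant c c′ | ≡.refl ← Decidable⇒UIP.≡-irrelevant ℤ._≟_ e e′ = ≡.refl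

DP-bounded : ∀ π {m} → largest π ≤ m → Bounded m (parts π)
DP-bounded (mkDP []       s p) h = [-] , p
DP-bounded (mkDP (l ∷ ls) s p) h = s≤s h ∷ s , p

bounded-DP : ∀ {m ls} → Bounded m ls → Σ DistinctPartition λ π → parts π ≡ ls × largest π ≤ m
bounded-DP {ls = []}    (_         , p) = mkDP _ []  p , ≡.refl , z≤n
bounded-DP {ls = _ ∷ _} (s≤s h ∷ s , p) = mkDP _ s p , ≡.refl , h

largest≤size : ∀ π → largest π ≤ size π
largest≤size (mkDP []       _ _) = z≤n
largest≤size (mkDP (l ∷ ls) _ _) = ℕₚ.m≤m+n l (sum ls)

length≤sum : ∀ {ls} → All (0 <_) ls → length ls ≤ sum ls
length≤sum []       = z≤n
length≤sum (p ∷ ps) = ℕₚ.+-mono-≤ p (length≤sum ps)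

n≤double : ∀ n → n ≤ double n
n≤double n = ≡.subst (n ≤_) (≡.sym (double-+ n)) (ℕₚ.m≤m+n n n)

ω-weight : ∀ a b → rowsWeight 1 a ℤ.+ rowsWeight 1 b ≡ weight (a , b)
ω-weight a b = cong₂ ℤ._+_ (rowsWeight-rowsWt 1 a) (rowsWeight-rowsWt 1 b)

theorem3p3 : (n : ℕ) (w : ℤ) →
    Σ ℕ (λ c → (Λ22ω n w ↔ Fin c) × (coeffX (RHS n) w ≡ + c))
theorem3p3 n w = length enum ,
  enumerate underlying enum (Unique.filter⁺ P? (pairs-unique n K)) underlying-injective complete sound ,
  ≡.trans (coeffX-cong (L.trans (RHS-truncated n) (L.sym (gf-pairs n K Q.at n))) w) (coeffX-gf weight total-size n w (pairs n K))
  where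
  -- The number of terms in `RHS-truncated`. It exceeds the length of every second component, which
  -- is at most its size and so at most `n`.
  K = double (suc n)
  P? = hasWeight? weight total-size n w
  enum = filter P? (pairs n K)

  complete : ∀ p → underlying p ∈ enum
  complete (mkΛ a b t c , e) = ∈-filter⁺ P?
    (pairs-complete n K (DP-bounded a c) (DP-bounded b (ℕₚ.≤-trans (largest≤size b) b≤n))
      (s≤s (ℕₚ.m≤n⇒m≤1+n (ℕₚ.≤-trans (length≤sum (positive b)) (ℕₚ.≤-trans b≤n (n≤double n))))))
    (t , ≡.trans (≡.sym (ω-weight (parts a) (parts b))) e)
    where
    b≤n : size b ≤ n
    b≤n = ℕₚ.m+n≤o⇒n≤o (size a) (ℕₚ.≤-reflexive t)

  sound : ∀ {ab} → ab ∈ enum → ∃ λ p → underlying p ≡ ab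
  sound {a , b} x with y , t , e ← ∈-filter⁻ P? {xs = pairs n K} x
    with p , q , _ ← pairs-sound n K y
    with bounded-DP p | bounded-DP q
  ... | π , ≡.refl , c | ρ , ≡.refl , _ = (mkΛ π ρ t c , ≡.trans (ω-weight a b) e) , ≡.refl
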